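{- Let $A$ be a set and let $f\colon X\to Y$ be a lax homomorphism between pointed $\mathcal{D}_{\le1}(A\times -)$-coalgebras $(X,c,i)$ and $(Y,d,j)$. If $(X,c,i)$ is reachable and $f$ is $(\mathbb{E}_{\mathcal{D}},\mathbb{S}_{\mathcal{D}})$-open, then $f$ is a proper homomorphism. Conversely, if $f$ is a proper homomorphism, then it is $(\mathbb{E}_{\mathcal{D}},\mathbb{S}_{\mathcal{D}})$-open. Moreover, two pointed $\mathcal{D}_{\le1}(A\times -)$-coalgebras $(X,c,i)$ and $(Y,d,j)$ are $(\mathbb{E}_{\mathcal{D}},\mathbb{S}_{\mathcal{D}})$-bisimilar if and only if they are coalgebraically bisimilar.
   Context: $\mathcal{D}_{\le1}X$ is the set of finitely supported $\mu\colon X\to[0,1]$ with $\sum_x\mu(x)\le1$; on maps, $\mathcal{D}_{\le1}(f)(\mu)(y)=\sum_{f(x)=y}\mu(x)$. Let $F=\mathcal{D}_{\le1}(A\times -)$. A pointed coalgebra $(X,c,x_0)$ is a set $X$, a map $c\colon X\to FX$ and $x_0\in X$. A lax homomorphism $(X,c,x_0)\to(Y,d,y_0)$ is a map $f$ with $f(x_0)=y_0$ and $(Ff\circ c)(x)(a,y)\le d(f(x))(a,y)$ for all $x,a,y$; it is proper if equality always holds. $\mathsf{LCoalg}(1,F)$ is the category of pointed coalgebras and lax homomorphisms. $X,Y$ are coalgebraically bisimilar if there are $Z$ and proper homomorphisms $Z\to X$, $Z\to Y$. Generalized open map situation: a category $\mathbb{M}$, a set $V$ with $J\colon V\to\mathrm{ob}(\mathbb{M})$,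 small categories $\mathbb{E},\mathbb{S}$ with object set $V$, functors $J_{\mathbb{E}}\colon\mathbb{E}\to\mathbb{M}$, $J_{\mathbb{S}}\colon\mathbb{S}\to\mathbb{M}$ coinciding with $J$ on objects. A morphism $f\colon X\to Y$ of $\mathbb{M}$ is $(\mathbb{E},\mathbb{S})$-open if for every $\epsilon\colon v\to w$ in $\mathbb{E}$ and all $x\colon Jv\to X$, $y\colon Jw\to Y$ in $\mathbb{M}$ with $y\circ J_{\mathbb{E}}\epsilon=f\circ x$ there are $u\in V$, $\epsilon'\colon v\to u$ in $\mathbb{E}$, $s\colon u\to w$ in $\mathbb{S}$, $x'\colon Ju\to X$ in $\mathbb{M}$ with $J_{\mathbb{S}}s\circ J_{\mathbb{E}}\epsilon'=J_{\mathbb{E}}\epsilon$, $x'\circ J_{\mathbb{E}}\epsilon'=x$, $f\circ x'=y\circ J_{\mathbb{S}}s$. $X,Y$ are $(\mathbb{E},\mathbb{S})$-bisimilar if there are $Z$ and $(\mathbb{E},\mathbb{S})$-open maps $Z\to X$, $Z\to Y$. The situation $(\mathbb{E}_{\mathcal{D}},\mathbb{S}_{\mathcal{D}})$ on $\mathbb{M}=\mathsf{LCoalg}(1,F)$: consider all finite words $w=(a_1,k_1)\cdots(a_n,k_n)$ over $A\times\mathbb{R}_{>0}$, and all triples $(w_1,b,w_2)$ with $w_1$ such a word, $b\in A$, $w_2=l_1\cdots l_m$ a non-empty word over $\mathbb{R}_{>0}$. $Jw$ has states $0,\dots,n$, initial state $0$, and weight $k_{i+1}$ from $i$ to $i+1$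 with letter $a_{i+1}$ ($0\le i<n$), all other weights being $0$. $J(w_1,b,w_2)$ has states $0,\dots,n$ and $(n+1,1),\dots,(n+1,m)$, initial state $0$, the transitions of $Jw_1$ together with weight $l_i$ from $n$ to $(n+1,i)$ with letter $b$, all other weights being $0$. The set $V$ consists of those words and triples $v$ for which $Jv$ is a $\mathcal{D}_{\le1}(A\times -)$-coalgebra (i.e. the total outgoing weight of each state is at most $1$). $\mathbb{E}_{\mathcal{D}}$ has as non-identity morphisms exactly one morphism $w_1\to(w_1,b,w_2)$ for all such elements of $V$; $J_{\mathbb{E}}$ sends it to the inclusion of states. $\mathbb{S}_{\mathcal{D}}$ has identities on words, and morphisms $(w_1,b,l'_1\cdots l'_{m'})\to(w_1,b,l_1\cdots l_m)$ (with $m\le m'$) given by monotone surjections $s\colon\{1,\dots,m'\}\to\{1,\dots,m\}$ with $l_i=\sum_{s(j)=i}l'_j$ for all $i$; $J_{\mathbb{S}}s$ maps $i\mapsto i$ and $(n+1,j)\mapsto(n+1,s(j))$. A state $p$ of $X$ is reachable if there are a word $w\in V$ of length $n$ and a lax homomorphism $x\colon Jw\to X$ with $x(n)=p$; $X$ is reachable if all its states are. -}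

module Defs where

open import Axiom.ExcludedMiddle using (ExcludedMiddle)
open import Data.Empty using (⊥-elim)
open import Data.Fin.Base as Fin using (Fin; fromℕ)
open import Data.Fin.Relation.Unary.Top using (View; ‵fromℕ; ‵inject₁; view)
open import Data.List.Base using (List; []; _∷_; map; filter; allFin; deduplicate)
open import Data.List.Membership.Propositional using (_∈_; _∉_)
open import Data.List.Membership.Propositional.Properties
  using (∈-map⁺; ∈-allFin; ∈-deduplicate⁺)
open import Data.List.Properties using (map-∘; map-id)
open import Data.List.Relation.Unary.All as All using ([]; _∷_)
open import Data.List.Relation.Unary.AllPairs using ([]; _∷_)
open import Data.List.Relation.Unary.Any using (here; there)
open import Data.List.Relation.Unary.Unique.Propositional using (Unique)
import Data.List.Relation.Unary.Unique.Propositional.Properties as Unique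
import Data.List.Relation.Unary.Unique.DecPropositional.Properties as DecUnique
open import Data.Nat.Base as ℕ using (ℕ; suc)
import Data.Nat.Properties as ℕ
open import Data.Product using (Σ; ∃; _×_; _,_; proj₁; proj₂; map₁; map₂)
open import Data.Rational.Base as ℚ using (ℚ; 0ℚ; 1ℚ; ½; ∣_∣)
import Data.Rational.Properties as ℚ
open import Data.Rational.Solver using (module +-*-Solver)
open import Data.Sum.Base using (_⊎_; inj₁; inj₂)
open import Data.Sum.Properties using (inj₂-injective)
open import Data.Unit.Base using (⊤; tt)
open import Data.Vec.Base using (Vec; lookup)
open import Function.Base using (_∘_; id)
open import Level using (Level; 0ℓ; _⊔_) renaming (suc to lsuc)
open import Relation.Binary.Definitions using (DecidableEquality)
open import Relation.Binary.Bundles using (Poset)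
import Relation.Binary.Reasoning.PartialOrder
open import Relation.Binary.Structures using (IsEquivalence)
open import Relation.Binary.PropositionalEquality
  using (_≡_; refl; sym; trans; cong; cong₂; subst; isEquivalence)
open import Relation.Nullary using (Dec; yes; no; ¬_)

------------------------------------------------------------------------
-- Real numbers: Cauchy sequences of rationals modulo null sequences.
-- There is no quotient, so _≈_ (not _≡_) is the equality of reals.

Eventually : (ℕ → Set) → Set
Eventually P = ∃ λ N → ∀ n → N ℕ.≤ n → P n

record ℝ : Set where
  no-eta-equality
  field
    seq    : ℕ → ℚ
    cauchy : ∀ ε → 0ℚ ℚ.< ε →
             ∃ λ N → ∀ m n → N ℕ.≤ m → N ℕ.≤ n → ∣ seq m ℚ.- seq n ∣ ℚ.≤ ε

open ℝ public

infix 4 _≈_ _≤_ _<_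
infixl 6 _+_

record _≈_ (x y : ℝ) : Set where
  constructor mk≈
  field
    close : ∀ ε → 0ℚ ℚ.< ε → Eventually λ n → ∣ seq x n ℚ.- seq y n ∣ ℚ.≤ ε

record _≤_ (x y : ℝ) : Set where
  constructor mk≤
  field
    below : ∀ ε → 0ℚ ℚ.< ε → Eventually λ n → seq x n ℚ.≤ seq y n ℚ.+ ε

record _<_ (x y : ℝ) : Set where
  constructor mk<
  field
    gap       : ℚ
    gap>0     : 0ℚ ℚ.< gap
    separated : Eventually λ n → seq x n ℚ.+ gap ℚ.≤ seq y n

open _≈_ public
open _≤_ public
open _<_ public

fromℚ : ℚ → ℝ
fromℚ q .seq    _ = q
fromℚ q .cauchy ε 0<ε = 0 , λ _ _ _ _ →
  subst (λ d → ∣ d ∣ ℚ.≤ ε) (sym (ℚ.+-inverseʳ q)) (ℚ.<⇒≤ 0<ε)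

0ℝ 1ℝ : ℝ
0ℝ = fromℚ 0ℚ
1ℝ = fromℚ 1ℚ

private
  half>0 : ∀ {ε} → 0ℚ ℚ.< ε → 0ℚ ℚ.< ε ℚ.* ½
  half>0 {ε} 0<ε = subst (ℚ._< ε ℚ.* ½) (ℚ.*-zeroˡ ½) (ℚ.*-monoˡ-<-pos ½ 0<ε)

  halves : ∀ ε → ε ℚ.* ½ ℚ.+ ε ℚ.* ½ ≡ ε
  halves ε = trans (sym (ℚ.*-distribˡ-+ ε ½ ½)) (ℚ.*-identityʳ ε)

  interchange : ∀ a b c d → (a ℚ.+ b) ℚ.+ (c ℚ.+ d) ≡ (a ℚ.+ c) ℚ.+ (b ℚ.+ d)
  interchange = solve 4 (λ a b c d → (a :+ b) :+ (c :+ d) := (a :+ c) :+ (b :+ d)) refl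
    where open +-*-Solver

  interchange-neg : ∀ a b c d → (a ℚ.+ b) ℚ.- (c ℚ.+ d) ≡ (a ℚ.- c) ℚ.+ (b ℚ.- d)
  interchange-neg = solve 4 (λ a b c d → (a :+ b) :- (c :+ d) := (a :- c) :+ (b :- d)) refl
    where open +-*-Solver

  sub-add : ∀ a b → (a ℚ.- b) ℚ.+ b ≡ a
  sub-add = solve 2 (λ a b → (a :- b) :+ b := a) refl
    where open +-*-Solver

  add-sub : ∀ a b → (b ℚ.+ a) ℚ.- b ≡ a
  add-sub = solve 2 (λ a b → (b :+ a) :- b := a) refl
    where open +-*-Solver

  neg-sub : ∀ a b → ℚ.- (a ℚ.- b) ≡ b ℚ.- a
  neg-sub = solve 2 (λ a b → :- (a :- b) := b :- a) refl
    where open +-*-Solver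

  p≤∣p∣ : ∀ p → p ℚ.≤ ∣ p ∣
  p≤∣p∣ p with ℚ.≤-total 0ℚ p
  ... | inj₁ 0≤p = ℚ.≤-reflexive (sym (ℚ.0≤p⇒∣p∣≡p 0≤p))
  ... | inj₂ p≤0 = ℚ.≤-trans p≤0 (ℚ.0≤∣p∣ p)

  ∣-∣≤⇒≤+ : ∀ {a b ε} → ∣ a ℚ.- b ∣ ℚ.≤ ε → a ℚ.≤ b ℚ.+ ε
  ∣-∣≤⇒≤+ {a} {b} {ε} d = begin
    a                 ≡⟨ sub-add a b ⟨
    (a ℚ.- b) ℚ.+ b   ≤⟨ ℚ.+-monoˡ-≤ b (ℚ.≤-trans (p≤∣p∣ _) d) ⟩
    ε ℚ.+ b           ≡⟨ ℚ.+-comm ε b ⟩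
    b ℚ.+ ε           ∎
    where open ℚ.≤-Reasoning

  ∣-∣-sym : ∀ a b → ∣ a ℚ.- b ∣ ≡ ∣ b ℚ.- a ∣
  ∣-∣-sym a b = trans (sym (ℚ.∣-p∣≡∣p∣ (a ℚ.- b))) (cong ∣_∣ (neg-sub a b))

  ≤+⇒-≤ : ∀ {a b ε} → a ℚ.≤ b ℚ.+ ε → a ℚ.- b ℚ.≤ ε
  ≤+⇒-≤ {a} {b} {ε} a≤ =
    subst (a ℚ.- b ℚ.≤_) (add-sub ε b) (ℚ.+-monoˡ-≤ (ℚ.- b) a≤)

  ≤+⇒∣-∣≤ : ∀ {a b ε} → a ℚ.≤ b ℚ.+ ε → b ℚ.≤ a ℚ.+ ε → ∣ a ℚ.- b ∣ ℚ.≤ ε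
  ≤+⇒∣-∣≤ {a} {b} {ε} a≤ b≤ with ℚ.∣p∣≡p∨∣p∣≡-p (a ℚ.- b)
  ... | inj₁ eq = subst (ℚ._≤ ε) (sym eq) (≤+⇒-≤ {a} {b} a≤)
  ... | inj₂ eq = subst (ℚ._≤ ε) (sym (trans eq (neg-sub a b))) (≤+⇒-≤ {b} {a} b≤)

  both : ∀ {P Q R : ℕ → Set} → (∀ n → P n → Q n → R n) →
         Eventually P → Eventually Q → Eventually R
  both f (M , p) (N , q) = M ℕ.⊔ N , λ n n≥ →
    f n (p n (ℕ.≤-trans (ℕ.m≤m⊔n M N) n≥)) (q n (ℕ.≤-trans (ℕ.m≤n⊔m M N) n≥))

_+_ : ℝ → ℝ → ℝ
seq    (x + y) n = seq x n ℚ.+ seq y n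
cauchy (x + y) ε 0<ε with cauchy x _ (half>0 0<ε) | cauchy y _ (half>0 0<ε)
... | M , p | N , q = M ℕ.⊔ N , λ m n m≥ n≥ →
  let m≥M = ℕ.≤-trans (ℕ.m≤m⊔n M N) m≥
      n≥M = ℕ.≤-trans (ℕ.m≤m⊔n M N) n≥
      m≥N = ℕ.≤-trans (ℕ.m≤n⊔m M N) m≥
      n≥N = ℕ.≤-trans (ℕ.m≤n⊔m M N) n≥
  in begin
  ∣ (seq x m ℚ.+ seq y m) ℚ.- (seq x n ℚ.+ seq y n) ∣
    ≡⟨ cong ∣_∣ (interchange-neg (seq x m) (seq y m) (seq x n) (seq y n)) ⟩
  ∣ (seq x m ℚ.- seq x n) ℚ.+ (seq y m ℚ.- seq y n) ∣
    ≤⟨ ℚ.∣p+q∣≤∣p∣+∣q∣ (seq x m ℚ.- seq x n) (seq y m ℚ.- seq y n) ⟩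
  ∣ seq x m ℚ.- seq x n ∣ ℚ.+ ∣ seq y m ℚ.- seq y n ∣
    ≤⟨ ℚ.+-mono-≤ (p m n m≥M n≥M) (q m n m≥N n≥N) ⟩
  ε ℚ.* ½ ℚ.+ ε ℚ.* ½
    ≡⟨ halves ε ⟩
  ε ∎
  where open ℚ.≤-Reasoning

≈⇒≤ : ∀ {x y} → x ≈ y → x ≤ y
≈⇒≤ x≈y .below ε 0<ε = map₂ (λ p n n≥ → ∣-∣≤⇒≤+ (p n n≥)) (close x≈y ε 0<ε)

≤-antisym : ∀ {x y} → x ≤ y → y ≤ x → x ≈ y
≤-antisym x≤y y≤x .close ε 0<ε =
  both (λ n → ≤+⇒∣-∣≤) (below x≤y ε 0<ε) (below y≤x ε 0<ε)

≈-sym : ∀ {x y} → x ≈ y → y ≈ x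
≈-sym {x} {y} x≈y .close ε 0<ε =
  map₂ (λ p n n≥ → subst (ℚ._≤ ε) (∣-∣-sym (seq x n) (seq y n)) (p n n≥)) (close x≈y ε 0<ε)

pointwise-≤ : ∀ {x y} → (∀ n → seq x n ℚ.≤ seq y n) → x ≤ y
pointwise-≤ {x} {y} p .below ε 0<ε = 0 , λ n _ →
  ℚ.≤-trans (p n) (subst (ℚ._≤ seq y n ℚ.+ ε) (ℚ.+-identityʳ (seq y n))
                         (ℚ.+-monoʳ-≤ (seq y n) (ℚ.<⇒≤ 0<ε)))

pointwise-≈ : ∀ {x y} → (∀ n → seq x n ≡ seq y n) → x ≈ y
pointwise-≈ p = ≤-antisym (pointwise-≤ (ℚ.≤-reflexive ∘ p))
                          (pointwise-≤ (ℚ.≤-reflexive ∘ sym ∘ p))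

≤-trans : ∀ {x y z} → x ≤ y → y ≤ z → x ≤ z
≤-trans {x} {y} {z} x≤y y≤z .below ε 0<ε =
  both (λ n p q → begin
    seq x n                                  ≤⟨ p ⟩
    seq y n ℚ.+ ε ℚ.* ½                      ≤⟨ ℚ.+-monoˡ-≤ _ q ⟩
    (seq z n ℚ.+ ε ℚ.* ½) ℚ.+ ε ℚ.* ½        ≡⟨ ℚ.+-assoc (seq z n) _ _ ⟩
    seq z n ℚ.+ (ε ℚ.* ½ ℚ.+ ε ℚ.* ½)        ≡⟨ cong (seq z n ℚ.+_) (halves ε) ⟩
    seq z n ℚ.+ ε                            ∎)
    (below x≤y _ (half>0 0<ε)) (below y≤z _ (half>0 0<ε))
  where open ℚ.≤-Reasoning

≈-refl : ∀ {x} → x ≈ x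
≈-refl = pointwise-≈ λ _ → refl

≈-trans : ∀ {x y z} → x ≈ y → y ≈ z → x ≈ z
≈-trans x≈y y≈z = ≤-antisym
  (≤-trans (≈⇒≤ x≈y) (≈⇒≤ y≈z))
  (≤-trans (≈⇒≤ (≈-sym y≈z)) (≈⇒≤ (≈-sym x≈y)))

≡⇒≈ : ∀ {x y} → x ≡ y → x ≈ y
≡⇒≈ refl = ≈-refl

≤-poset : Poset 0ℓ 0ℓ 0ℓ
≤-poset = record
  { _≈_ = _≈_ ; _≤_ = _≤_
  ; isPartialOrder = record
    { isPreorder = record
      { isEquivalence = record { refl = ≈-refl ; sym = ≈-sym ; trans = ≈-trans }
      ; reflexive = ≈⇒≤ ; trans = ≤-trans }
    ; antisym = ≤-antisym } }

open Poset ≤-poset public using () renaming (refl to ≤-refl)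

module ≤-Reasoning = Relation.Binary.Reasoning.PartialOrder ≤-poset

+-mono-≤ : ∀ {x y u v} → x ≤ y → u ≤ v → x + u ≤ y + v
+-mono-≤ {x} {y} {u} {v} x≤y u≤v .below ε 0<ε =
  both (λ n p q → begin
    seq x n ℚ.+ seq u n                              ≤⟨ ℚ.+-mono-≤ p q ⟩
    (seq y n ℚ.+ ε ℚ.* ½) ℚ.+ (seq v n ℚ.+ ε ℚ.* ½)  ≡⟨ interchange (seq y n) _ (seq v n) _ ⟩
    (seq y n ℚ.+ seq v n) ℚ.+ (ε ℚ.* ½ ℚ.+ ε ℚ.* ½)  ≡⟨ cong (seq y n ℚ.+ seq v n ℚ.+_) (halves ε) ⟩
    (seq y n ℚ.+ seq v n) ℚ.+ ε                      ∎)
    (below x≤y _ (half>0 0<ε)) (below u≤v _ (half>0 0<ε))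
  where open ℚ.≤-Reasoning

+-cong : ∀ {x y u v} → x ≈ y → u ≈ v → x + u ≈ y + v
+-cong x≈y u≈v = ≤-antisym
  (+-mono-≤ (≈⇒≤ x≈y) (≈⇒≤ u≈v))
  (+-mono-≤ (≈⇒≤ (≈-sym x≈y)) (≈⇒≤ (≈-sym u≈v)))

+-identityˡ : ∀ x → 0ℝ + x ≈ x
+-identityˡ x = pointwise-≈ λ n → ℚ.+-identityˡ (seq x n)

+-identityʳ : ∀ x → x + 0ℝ ≈ x
+-identityʳ x = pointwise-≈ λ n → ℚ.+-identityʳ (seq x n)

+-interchange : ∀ x y u v → (x + y) + (u + v) ≈ (x + u) + (y + v)
+-interchange x y u v =
  pointwise-≈ λ n → interchange (seq x n) (seq y n) (seq u n) (seq v n)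

<⇒≤ : ∀ {x y} → x < y → x ≤ y
<⇒≤ {x} {y} (mk< δ 0<δ (N , p)) .below ε 0<ε = N , λ n n≥ → begin
  seq x n          ≡⟨ ℚ.+-identityʳ (seq x n) ⟨
  seq x n ℚ.+ 0ℚ   ≤⟨ ℚ.+-monoʳ-≤ (seq x n) (ℚ.<⇒≤ 0<δ) ⟩
  seq x n ℚ.+ δ    ≤⟨ p n n≥ ⟩
  seq y n          ≡⟨ ℚ.+-identityʳ (seq y n) ⟨
  seq y n ℚ.+ 0ℚ   ≤⟨ ℚ.+-monoʳ-≤ (seq y n) (ℚ.<⇒≤ 0<ε) ⟩
  seq y n ℚ.+ ε    ∎
  where open ℚ.≤-Reasoning

record ℝ⁺ : Set where
  field
    value    : ℝ
    positive : 0ℝ < value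

open ℝ⁺ public

value≥0 : ∀ k → 0ℝ ≤ value k
value≥0 k = <⇒≤ (positive k)

∑ : {X : Set} → List X → (X → ℝ) → ℝ
∑ []       f = 0ℝ
∑ (x ∷ xs) f = f x + ∑ xs f

private
  variable
    X Y Z : Set

∑-mono : (xs : List X) {f g : X → ℝ} → (∀ {x} → x ∈ xs → f x ≤ g x) → ∑ xs f ≤ ∑ xs g
∑-mono []       f≤g = ≤-refl
∑-mono (x ∷ xs) f≤g = +-mono-≤ (f≤g (here refl)) (∑-mono xs (f≤g ∘ there))

∑-cong : (xs : List X) {f g : X → ℝ} → (∀ x → f x ≈ g x) → ∑ xs f ≈ ∑ xs g
∑-cong []       f≈g = ≈-refl
∑-cong (x ∷ xs) f≈g = +-cong (f≈g x) (∑-cong xs f≈g)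

∑-0 : (xs : List X) → ∑ xs (λ _ → 0ℝ) ≈ 0ℝ
∑-0 []       = ≈-refl
∑-0 (x ∷ xs) = ≈-trans (+-identityˡ _) (∑-0 xs)

∑-≥0 : (xs : List X) {f : X → ℝ} → (∀ x → 0ℝ ≤ f x) → 0ℝ ≤ ∑ xs f
∑-≥0 xs f≥0 = ≤-trans (≈⇒≤ (≈-sym (∑-0 xs))) (∑-mono xs λ {x} _ → f≥0 x)

∑-∈ : {xs : List X} {f : X → ℝ} → (∀ x → 0ℝ ≤ f x) → ∀ {x} → x ∈ xs → f x ≤ ∑ xs f
∑-∈ {xs = _ ∷ xs} f≥0 (here refl) =
  ≤-trans (≈⇒≤ (≈-sym (+-identityʳ _))) (+-mono-≤ ≤-refl (∑-≥0 xs f≥0))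
∑-∈ f≥0 (there {x = x} x∈xs) =
  ≤-trans (≈⇒≤ (≈-sym (+-identityˡ _))) (+-mono-≤ (f≥0 x) (∑-∈ f≥0 x∈xs))

∑-+ : (xs : List X) (f g : X → ℝ) → ∑ xs (λ x → f x + g x) ≈ ∑ xs f + ∑ xs g
∑-+ []       f g = ≈-sym (+-identityˡ 0ℝ)
∑-+ (x ∷ xs) f g =
  ≈-trans (+-cong ≈-refl (∑-+ xs f g)) (+-interchange (f x) (g x) (∑ xs f) (∑ xs g))

∑-swap : (xs : List X) (ys : List Y) (f : X → Y → ℝ) →
         ∑ xs (λ x → ∑ ys (f x)) ≈ ∑ ys (λ y → ∑ xs (λ x → f x y))
∑-swap []       ys f = ≈-sym (∑-0 ys)
∑-swap (x ∷ xs) ys f =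
  ≈-trans (+-cong ≈-refl (∑-swap xs ys f)) (≈-sym (∑-+ ys (f x) _))

when : {P : Set} → Dec P → ℝ → ℝ
when (yes _) r = r
when (no  _) r = 0ℝ

when-≥0 : {P : Set} (p : Dec P) {r : ℝ} → 0ℝ ≤ r → 0ℝ ≤ when p r
when-≥0 (yes _) r≥0 = r≥0
when-≥0 (no  _) r≥0 = ≤-refl

when-yes : {P : Set} (p : Dec P) {r : ℝ} → P → r ≤ when p r
when-yes (yes _) _ = ≤-refl
when-yes (no ¬p) p = ⊥-elim (¬p p)

when-no : {P : Set} (p : Dec P) {r : ℝ} → ¬ P → when p r ≈ 0ℝ
when-no (yes p) ¬p = ⊥-elim (¬p p)
when-no (no  _) _  = ≈-refl

when-≤ : {P : Set} (p : Dec P) {r : ℝ} → 0ℝ ≤ r → when p r ≤ r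
when-≤ (yes _) r≥0 = ≤-refl
when-≤ (no  _) r≥0 = r≥0

when-mono : {P : Set} (p : Dec P) {r s : ℝ} → (P → r ≤ s) → when p r ≤ when p s
when-mono (yes p) r≤s = r≤s p
when-mono (no  _) r≤s = ≤-refl

when-∑ : {P : Set} (p : Dec P) (xs : List X) (f : X → ℝ) →
         when p (∑ xs f) ≈ ∑ xs (λ x → when p (f x))
when-∑ (yes _) xs f = ≈-refl
when-∑ (no  _) xs f = ≈-sym (∑-0 xs)

------------------------------------------------------------------------
-- The type of objects is a parameter, so that two categories can have the
-- same objects and a functor can have a prescribed action on them.

record Category {o} (Obj : Set o) (ℓ e : Level) : Set (o ⊔ lsuc (ℓ ⊔ e)) where
  infix  4 _≋_
  infixr 9 _⊚_
  field
    Hom       : Obj → Obj → Set ℓ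
    _≋_       : ∀ {a b} → Hom a b → Hom a b → Set e
    ident     : ∀ {a} → Hom a a
    _⊚_       : ∀ {a b c} → Hom b c → Hom a b → Hom a c
    equiv     : ∀ {a b} → IsEquivalence (_≋_ {a} {b})
    ⊚-cong    : ∀ {a b c} {f f′ : Hom b c} {g g′ : Hom a b} →
                f ≋ f′ → g ≋ g′ → f ⊚ g ≋ f′ ⊚ g′
    assoc     : ∀ {a b c d} {f : Hom c d} {g : Hom b c} {h : Hom a b} →
                (f ⊚ g) ⊚ h ≋ f ⊚ (g ⊚ h)
    identityˡ : ∀ {a b} {f : Hom a b} → ident ⊚ f ≋ f
    identityʳ : ∀ {a b} {f : Hom a b} → f ⊚ ident ≋ f

record FunctorOver {v o ℓ e ℓ′ e′} {V : Set v} {Obj : Set o}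
  (C : Category V ℓ e) (M : Category Obj ℓ′ e′) (J : V → Obj) :
  Set (v ⊔ ℓ ⊔ e ⊔ ℓ′ ⊔ e′) where
  private
    module C = Category C
    module M = Category M
  field
    F₁           : ∀ {v w} → C.Hom v w → M.Hom (J v) (J w)
    F₁-cong      : ∀ {v w} {f g : C.Hom v w} → f C.≋ g → F₁ f M.≋ F₁ g
    identity     : ∀ {v} → F₁ (C.ident {v}) M.≋ M.ident
    homomorphism : ∀ {u v w} {f : C.Hom v w} {g : C.Hom u v} →
                   F₁ (f C.⊚ g) M.≋ F₁ f M.⊚ F₁ g

record OpenMapSituation {o ℓ e} {Obj : Set o} (M : Category Obj ℓ e) :
  Set (lsuc 0ℓ ⊔ o ⊔ ℓ ⊔ e) where
  field
    V  : Set
    J  : V → Obj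
    𝔼  : Category V 0ℓ 0ℓ
    𝕊  : Category V 0ℓ 0ℓ
    J𝔼 : FunctorOver 𝔼 M J
    J𝕊 : FunctorOver 𝕊 M J

  private
    module 𝔼 = Category 𝔼
    module 𝕊 = Category 𝕊
  open Category M
  open FunctorOver J𝔼 renaming (F₁ to J𝔼₁) using ()
  open FunctorOver J𝕊 renaming (F₁ to J𝕊₁) using ()

  IsOpen : ∀ {X Y} → Hom X Y → Set (ℓ ⊔ e)
  IsOpen {X} {Y} f =
    ∀ {v w} (ϵ : 𝔼.Hom v w) (x : Hom (J v) X) (y : Hom (J w) Y) →
    y ⊚ J𝔼₁ ϵ ≋ f ⊚ x →
    ∃ λ u → Σ (𝔼.Hom v u) λ ϵ′ → Σ (𝕊.Hom u w) λ s → Σ (Hom (J u) X) λ x′ →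
      J𝕊₁ s ⊚ J𝔼₁ ϵ′ ≋ J𝔼₁ ϵ × x′ ⊚ J𝔼₁ ϵ′ ≋ x × f ⊚ x′ ≋ y ⊚ J𝕊₁ s

  Bisimilar : Obj → Obj → Set (o ⊔ ℓ ⊔ e)
  Bisimilar X Y =
    ∃ λ Z → Σ (Hom Z X) λ f → Σ (Hom Z Y) λ g → IsOpen f × IsOpen g

------------------------------------------------------------------------
-- Subdistributions. Summing over the fibres of an arbitrary map is not
-- constructively meaningful, so excluded middle is assumed from here on.

module Subdistributions (em : ExcludedMiddle 0ℓ) where

  ∑[_∣_] : List X → (X → Set) → (X → ℝ) → ℝ
  ∑[ xs ∣ P ] f = ∑ (filter (λ x → em {P x}) xs) f

  ∑-filter : (xs : List X) (P : X → Set) (f : X → ℝ) →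
             ∑[ xs ∣ P ] f ≈ ∑ xs (λ x → when (em {P x}) (f x))
  ∑-filter []       P f = ≈-refl
  ∑-filter (x ∷ xs) P f with em {P x}
  ... | yes _ = +-cong ≈-refl (∑-filter xs P f)
  ... | no  _ = ≈-trans (∑-filter xs P f) (≈-sym (+-identityˡ _))

  ∑-unique : {xs : List X} → Unique xs → ∀ k {r} → 0ℝ ≤ r →
             ∑ xs (λ x → when (em {k ≡ x}) r) ≤ r
  ∑-unique []             k r≥0 = r≥0
  ∑-unique {xs = x ∷ xs} (x∉ ∷ uniq) k {r} r≥0 with em {k ≡ x}
  ... | no  _    = ≤-trans (≈⇒≤ (+-identityˡ _)) (∑-unique uniq k r≥0)
  ... | yes refl = ≤-trans
    (+-mono-≤ ≤-refl (≤-trans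
      (∑-mono xs λ {y} y∈ → ≈⇒≤ (when-no (em {k ≡ y}) (All.lookup x∉ y∈)))
      (≈⇒≤ (∑-0 xs))))
    (≈⇒≤ (+-identityʳ r))

  ∑-all : (xs : List X) {P : X → Set} → (∀ x → P x) → (f : X → ℝ) → ∑ xs f ≈ ∑[ xs ∣ P ] f
  ∑-all []       {P} p f = ≈-refl
  ∑-all (x ∷ xs) {P} p f with em {P x}
  ... | yes _  = +-cong ≈-refl (∑-all xs p f)
  ... | no ¬px = ⊥-elim (¬px (p x))

  ∑∣-≥0 : (xs : List X) (P : X → Set) {f : X → ℝ} → (∀ x → 0ℝ ≤ f x) → 0ℝ ≤ ∑[ xs ∣ P ] f
  ∑∣-≥0 xs P f≥0 = ∑-≥0 (filter (λ x → em {P x}) xs) f≥0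

  ∑∣-mono : (xs : List X) (P : X → Set) {f g : X → ℝ} → (∀ x → f x ≤ g x) →
            ∑[ xs ∣ P ] f ≤ ∑[ xs ∣ P ] g
  ∑∣-mono xs P f≤g = ∑-mono (filter (λ x → em {P x}) xs) λ {x} _ → f≤g x

  ∑∣-cong : (xs : List X) (P : X → Set) {f g : X → ℝ} → (∀ x → f x ≈ g x) →
            ∑[ xs ∣ P ] f ≈ ∑[ xs ∣ P ] g
  ∑∣-cong xs P f≈g = ∑-cong (filter (λ x → em {P x}) xs) f≈g

  ∑∣-∈ : (xs : List X) (P : X → Set) {f : X → ℝ} → (∀ x → 0ℝ ≤ f x) →
         ∀ {x} → x ∈ xs → P x → f x ≤ ∑[ xs ∣ P ] f
  ∑∣-∈ xs P {f} f≥0 {x} x∈ px = begin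
    f x                                ≤⟨ when-yes (em {P x}) px ⟩
    when (em {P x}) (f x)              ≤⟨ ∑-∈ (λ z → when-≥0 (em {P z}) (f≥0 z)) x∈ ⟩
    ∑ xs (λ z → when (em {P z}) (f z)) ≈⟨ ∑-filter xs P f ⟨
    ∑[ xs ∣ P ] f                      ∎
    where open ≤-Reasoning

  ∑∣-∅ : (xs : List X) (P : X → Set) {f : X → ℝ} → (∀ {x} → x ∈ xs → ¬ P x) →
         ∑[ xs ∣ P ] f ≈ 0ℝ
  ∑∣-∅ []       P ¬p = ≈-refl
  ∑∣-∅ (x ∷ xs) P ¬p with em {P x}
  ... | yes px = ⊥-elim (¬p (here refl) px)
  ... | no  _  = ∑∣-∅ xs P (¬p ∘ there)

  ∑∣-map : (h : X → Y) (xs : List X) (P : Y → Set) (f : Y → ℝ) →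
           ∑[ map h xs ∣ P ] f ≡ ∑[ xs ∣ P ∘ h ] (f ∘ h)
  ∑∣-map h []       P f = refl
  ∑∣-map h (x ∷ xs) P f with em {P (h x)}
  ... | yes _ = cong (f (h x) +_) (∑∣-map h xs P f)
  ... | no  _ = ∑∣-map h xs P f

  ∑∣-single : {xs : List X} → Unique xs → {f : X → ℝ} → (∀ x → 0ℝ ≤ f x) →
              ∀ k → ∑[ xs ∣ _≡ k ] f ≤ f k
  ∑∣-single {xs = xs} uniq {f} f≥0 k = begin
    ∑[ xs ∣ _≡ k ] f                         ≈⟨ ∑-filter xs (_≡ k) f ⟩
    ∑ xs (λ x → when (em {x ≡ k}) (f x))     ≤⟨ ∑-mono xs (λ {x} _ → flip x (em {x ≡ k})) ⟩
    ∑ xs (λ x → when (em {k ≡ x}) (f k))     ≤⟨ ∑-unique uniq k (f≥0 k) ⟩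
    f k                                      ∎
    where
    open ≤-Reasoning
    flip : ∀ x (d : Dec (x ≡ k)) → when d (f x) ≤ when (em {k ≡ x}) (f k)
    flip x (yes refl) = when-yes (em {k ≡ x}) refl
    flip x (no  _)    = when-≥0 (em {k ≡ x}) (f≥0 k)

  module _ (S : List X) (T : List Y) (φ : X → Y) (R : Y → Set)
           {μ : X → ℝ} (μ≥0 : ∀ x → 0ℝ ≤ μ x) where
    private
      cell : X → Y → ℝ
      cell x y = when (em {R y}) (when (em {φ x ≡ y}) (μ x))

      cell≥0 : ∀ x y → 0ℝ ≤ cell x y
      cell≥0 x y = when-≥0 (em {R y}) (when-≥0 (em {φ x ≡ y}) (μ≥0 x))

      ∑-fibres : ∑[ T ∣ R ] (λ y → ∑[ S ∣ (λ x → φ x ≡ y) ] μ) ≈ ∑ S (λ x → ∑ T (cell x))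
      ∑-fibres = begin-equality
        ∑[ T ∣ R ] (λ y → ∑[ S ∣ (λ x → φ x ≡ y) ] μ)
          ≈⟨ ∑∣-cong T R (λ y → ∑-filter S (λ x → φ x ≡ y) μ) ⟩
        ∑[ T ∣ R ] (λ y → ∑ S (λ x → when (em {φ x ≡ y}) (μ x)))
          ≈⟨ ∑-filter T R _ ⟩
        ∑ T (λ y → when (em {R y}) (∑ S (λ x → when (em {φ x ≡ y}) (μ x))))
          ≈⟨ ∑-cong T (λ y → when-∑ (em {R y}) S _) ⟩
        ∑ T (λ y → ∑ S (λ x → cell x y))
          ≈⟨ ∑-swap S T cell ⟨
        ∑ S (λ x → ∑ T (cell x)) ∎
        where open ≤-Reasoning

    ∑∣-into-fibres : (∀ {x} → x ∈ S → φ x ∈ T ⊎ μ x ≤ 0ℝ) →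
      ∑[ S ∣ R ∘ φ ] μ ≤ ∑[ T ∣ R ] (λ y → ∑[ S ∣ (λ x → φ x ≡ y) ] μ)
    ∑∣-into-fibres covered = begin
      ∑[ S ∣ R ∘ φ ] μ                            ≈⟨ ∑-filter S (R ∘ φ) μ ⟩
      ∑ S (λ x → when (em {R (φ x)}) (μ x))       ≤⟨ ∑-mono S (λ x∈ → term (covered x∈)) ⟩
      ∑ S (λ x → ∑ T (cell x))                    ≈⟨ ∑-fibres ⟨
      ∑[ T ∣ R ] (λ y → ∑[ S ∣ (λ x → φ x ≡ y) ] μ) ∎
      where
      open ≤-Reasoning
      term : ∀ {x} → φ x ∈ T ⊎ μ x ≤ 0ℝ → when (em {R (φ x)}) (μ x) ≤ ∑ T (cell x)
      term {x} (inj₁ φx∈T) = ≤-trans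
        (when-mono (em {R (φ x)}) (λ _ → when-yes (em {φ x ≡ φ x}) refl))
        (∑-∈ (cell≥0 x) φx∈T)
      term {x} (inj₂ μx≤0) = ≤-trans
        (when-≤ (em {R (φ x)}) (μ≥0 x)) (≤-trans μx≤0 (∑-≥0 T (cell≥0 x)))

    ∑∣-from-fibres : Unique T →
      ∑[ T ∣ R ] (λ y → ∑[ S ∣ (λ x → φ x ≡ y) ] μ) ≤ ∑[ S ∣ R ∘ φ ] μ
    ∑∣-from-fibres uniq = begin
      ∑[ T ∣ R ] (λ y → ∑[ S ∣ (λ x → φ x ≡ y) ] μ) ≈⟨ ∑-fibres ⟩
      ∑ S (λ x → ∑ T (cell x))
        ≤⟨ ∑-mono S (λ {x} _ → ≤-trans (∑-mono T (λ {y} _ → term x y (em {φ x ≡ y})))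
                                       (∑-unique uniq (φ x) (rhs≥0 x))) ⟩
      ∑ S (λ x → when (em {R (φ x)}) (μ x))       ≈⟨ ∑-filter S (R ∘ φ) μ ⟨
      ∑[ S ∣ R ∘ φ ] μ                            ∎
      where
      open ≤-Reasoning
      rhs : X → ℝ
      rhs x = when (em {R (φ x)}) (μ x)
      rhs≥0 : ∀ x → 0ℝ ≤ rhs x
      rhs≥0 x = when-≥0 (em {R (φ x)}) (μ≥0 x)
      term : ∀ x y (d : Dec (φ x ≡ y)) → when (em {R y}) (when d (μ x)) ≤ when d (rhs x)
      term x y (yes refl) = ≤-refl
      term x y (no  _)    = when-≤ (em {R y}) ≤-refl

  -- The bound weight x ≤ 1 follows from nonneg, vanishes and total≤1. The
  -- support list may be larger than the set of points of non-zero weight.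
  record 𝒟≤1 (X : Set) : Set where
    field
      weight   : X → ℝ
      support  : List X
      distinct : Unique support
      vanishes : ∀ {x} → x ∉ support → weight x ≈ 0ℝ
      nonneg   : ∀ x → 0ℝ ≤ weight x
      total≤1  : ∑ support weight ≤ 1ℝ

  open 𝒟≤1 public

  private
    _≟_ : DecidableEquality X
    x ≟ y = em {x ≡ y}

  𝒟≤1-map : (X → Y) → 𝒟≤1 X → 𝒟≤1 Y
  𝒟≤1-map f μ .weight y = ∑[ support μ ∣ (λ x → f x ≡ y) ] (weight μ)
  𝒟≤1-map f μ .support  = deduplicate _≟_ (map f (support μ))
  𝒟≤1-map f μ .distinct = DecUnique.deduplicate-! _≟_ (map f (support μ))
  𝒟≤1-map f μ .vanishes {y} y∉ = ∑∣-∅ (support μ) (λ x → f x ≡ y)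
    λ { x∈ refl → y∉ (∈-deduplicate⁺ _≟_ (∈-map⁺ f x∈)) }
  𝒟≤1-map f μ .nonneg y = ∑∣-≥0 (support μ) (λ x → f x ≡ y) (nonneg μ)
  𝒟≤1-map f μ .total≤1  = begin
    ∑ T ν                            ≈⟨ ∑-all T (λ _ → tt) ν ⟩
    ∑[ T ∣ (λ _ → ⊤) ] ν             ≤⟨ ∑∣-from-fibres (support μ) T f (λ _ → ⊤) (nonneg μ)
                                          (DecUnique.deduplicate-! _≟_ (map f (support μ))) ⟩
    ∑[ support μ ∣ (λ _ → ⊤) ] (weight μ) ≈⟨ ∑-all (support μ) (λ _ → tt) (weight μ) ⟨
    ∑ (support μ) (weight μ)         ≤⟨ total≤1 μ ⟩
    1ℝ                               ∎
    where
    open ≤-Reasoning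
    T = deduplicate _≟_ (map f (support μ))
    ν = λ y → ∑[ support μ ∣ (λ x → f x ≡ y) ] (weight μ)

  𝒟≤1-map-id : (μ : 𝒟≤1 X) → ∀ x → 𝒟≤1-map id μ .weight x ≤ μ .weight x
  𝒟≤1-map-id μ x = ∑∣-single (distinct μ) (nonneg μ) x

  𝒟≤1-map-∘ : (φ : X → Y) (ψ : Y → Z) (μ : 𝒟≤1 X) (ν : 𝒟≤1 Y) →
              (∀ y → 𝒟≤1-map φ μ .weight y ≤ ν .weight y) →
              ∀ z → 𝒟≤1-map (ψ ∘ φ) μ .weight z ≤ 𝒟≤1-map ψ ν .weight z
  𝒟≤1-map-∘ φ ψ μ ν φμ≤ν z = ≤-trans
    (∑∣-into-fibres (support μ) (support ν) φ (λ y → ψ y ≡ z) (nonneg μ) covered)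
    (∑∣-mono (support ν) (λ y → ψ y ≡ z) φμ≤ν)
    where
    covered : ∀ {x} → x ∈ support μ → φ x ∈ support ν ⊎ weight μ x ≤ 0ℝ
    covered {x} x∈ with em {φ x ∈ support ν}
    ... | yes φx∈ = inj₁ φx∈
    ... | no  φx∉ = inj₂ (≤-trans
      (∑∣-∈ (support μ) (λ x′ → φ x′ ≡ φ x) (nonneg μ) x∈ refl)
      (≤-trans (φμ≤ν (φ x)) (≈⇒≤ (vanishes ν φx∉))))

  -- The finite sum of point masses given by a list of weighted points.
  massAt : List (X × ℝ⁺) → X → ℝ
  massAt L x = ∑[ L ∣ (λ e → proj₁ e ≡ x) ] (value ∘ proj₂)

  massAt≥0 : (L : List (X × ℝ⁺)) → ∀ x → 0ℝ ≤ massAt L x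
  massAt≥0 L x = ∑∣-≥0 L (λ e → proj₁ e ≡ x) (λ e → value≥0 (proj₂ e))

  pointMasses : (L : List (X × ℝ⁺)) → Unique (map proj₁ L) →
                ∑ (map proj₁ L) (massAt L) ≤ 1ℝ → 𝒟≤1 X
  pointMasses L uniq total = record
    { weight   = massAt L
    ; support  = map proj₁ L
    ; distinct = uniq
    ; vanishes = λ {x} x∉ → ∑∣-∅ L (λ e → proj₁ e ≡ x) λ { e∈ refl → x∉ (∈-map⁺ proj₁ e∈) }
    ; nonneg   = massAt≥0 L
    ; total≤1  = total
    }

  𝒟≤1-map-pointMasses : (f : X → Y) (L : List (X × ℝ⁺))
    (uniq : Unique (map proj₁ L)) (total : ∑ (map proj₁ L) (massAt L) ≤ 1ℝ) →
    ∀ y → 𝒟≤1-map f (pointMasses L uniq total) .weight y ≤ massAt (map (map₁ f) L) y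
  𝒟≤1-map-pointMasses f L uniq total y = begin
    ∑[ map proj₁ L ∣ (λ x → f x ≡ y) ] (massAt L)
      ≤⟨ ∑∣-from-fibres L (map proj₁ L) proj₁ (λ x → f x ≡ y)
           (λ e → value≥0 (proj₂ e)) uniq ⟩
    ∑[ L ∣ (λ e → f (proj₁ e) ≡ y) ] (value ∘ proj₂)
      ≡⟨ ∑∣-map (map₁ f) L (λ e → proj₁ e ≡ y) (value ∘ proj₂) ⟨
    massAt (map (map₁ f) L) y ∎
    where open ≤-Reasoning

module Coalgebras (em : ExcludedMiddle 0ℓ) (A : Set) where

  open Subdistributions em public

  F : Set → Set
  F X = 𝒟≤1 (A × X)

  F-map : (X → Y) → F X → F Y
  F-map f = 𝒟≤1-map (map₂ f)

  record PointedCoalgebra : Set₁ where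
    field
      State : Set
      step  : State → F State
      init  : State

  open PointedCoalgebra public

  record LaxHom (X Y : PointedCoalgebra) : Set where
    field
      fun      : State X → State Y
      fun-init : fun (init X) ≡ init Y
      lax      : ∀ x a y →
                 weight (F-map fun (step X x)) (a , y) ≤ weight (step Y (fun x)) (a , y)

  open LaxHom public

  IsProper : ∀ {X Y} → LaxHom X Y → Set
  IsProper {X} {Y} f =
    ∀ x a y → weight (F-map (fun f) (step X x)) (a , y) ≈ weight (step Y (fun f x)) (a , y)

  CoalgebraicallyBisimilar : PointedCoalgebra → PointedCoalgebra → Set₁
  CoalgebraicallyBisimilar X Y =
    ∃ λ Z → Σ (LaxHom Z X) λ f → Σ (LaxHom Z Y) λ g → IsProper f × IsProper g

  LCoalg : Category PointedCoalgebra 0ℓ 0ℓ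
  LCoalg = record
    { Hom = LaxHom
    ; _≋_ = λ f g → ∀ x → fun f x ≡ fun g x
    ; ident = λ {X} → record
      { fun = id ; fun-init = refl ; lax = λ x a y → 𝒟≤1-map-id (step X x) (a , y) }
    ; _⊚_ = λ {X} {Y} {Z} g f → record
      { fun      = fun g ∘ fun f
      ; fun-init = trans (cong (fun g) (fun-init f)) (fun-init g)
      ; lax      = λ x a z → ≤-trans
          (𝒟≤1-map-∘ (map₂ (fun f)) (map₂ (fun g)) (step X x) (step Y (fun f x))
                     (λ (a , y) → lax f x a y) (a , z))
          (lax g (fun f x) a z)
      }
    ; equiv = record
      { refl = λ _ → refl ; sym = λ p x → sym (p x) ; trans = λ p q x → trans (p x) (q x) }
    ; ⊚-cong = λ {_} {_} {_} {f} {f′} {g} {g′} p q x → trans (p (fun g x)) (cong (fun f′) (q x))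
    ; assoc = λ _ → refl
    ; identityˡ = λ _ → refl
    ; identityʳ = λ _ → refl
    }

  -- fork w b l is the triple (w , b , l).
  data Shape : Set where
    word : ∀ {n} → Vec (A × ℝ⁺) n → Shape
    fork : ∀ {n} → Vec (A × ℝ⁺) n → A → ∀ {m} → Vec ℝ⁺ (suc m) → Shape

  -- In a fork, inj₂ i is the state (n+1 , i).
  States : Shape → Set
  States (word {n} w)         = Fin (suc n)
  States (fork {n} w b {m} l) = Fin (suc n) ⊎ Fin (suc m)

  start : ∀ v → States v
  start (word w)     = Fin.zero
  start (fork w b l) = inj₁ Fin.zero

  spine : ∀ {n} → Vec (A × ℝ⁺) n → Fin n → (A × Fin (suc n)) × ℝ⁺
  spine w i = (proj₁ (lookup w i) , Fin.suc i) , proj₂ (lookup w i)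

  leaf : ∀ {m} → A → Vec ℝ⁺ (suc m) → {S : Set} → Fin (suc m) → (A × (S ⊎ Fin (suc m))) × ℝ⁺
  leaf b l i = (b , inj₂ i) , lookup l i

  wordOut : ∀ {n} → Vec (A × ℝ⁺) n → {i : Fin (suc n)} → View i → List ((A × Fin (suc n)) × ℝ⁺)
  wordOut w (‵inject₁ i) = spine w i ∷ []
  wordOut w ‵fromℕ       = []

  forkOut : ∀ {n} → Vec (A × ℝ⁺) n → A → ∀ {m} → Vec ℝ⁺ (suc m) → {i : Fin (suc n)} → View i →
            List ((A × (Fin (suc n) ⊎ Fin (suc m))) × ℝ⁺)
  forkOut w b {m} l (‵inject₁ i) = map₁ (map₂ inj₁) (spine w i) ∷ []
  forkOut w b {m} l ‵fromℕ       = map (leaf b l) (allFin (suc m))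

  transitions : ∀ v → States v → List ((A × States v) × ℝ⁺)
  transitions (word w)     i        = wordOut w (view i)
  transitions (fork w b l) (inj₁ i) = forkOut w b l (view i)
  transitions (fork w b l) (inj₂ i) = []

  transitions-distinct : ∀ v s → Unique (map proj₁ (transitions v s))
  transitions-distinct (word w) i with view i
  ... | ‵fromℕ     = []
  ... | ‵inject₁ _ = [] ∷ []
  transitions-distinct (fork w b l) (inj₂ i) = []
  transitions-distinct (fork w b {m} l) (inj₁ i) with view i
  ... | ‵inject₁ _ = [] ∷ []
  ... | ‵fromℕ     = subst Unique (map-∘ (allFin (suc m)))
    (Unique.map⁺ (inj₂-injective ∘ cong proj₂) (Unique.allFin⁺ (suc m)))

  Valid : Shape → Set
  Valid v = ∀ s → ∑ (map proj₁ (transitions v s)) (massAt (transitions v s)) ≤ 1ℝ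

  V : Set
  V = Σ Shape Valid

  J : V → PointedCoalgebra
  J (v , valid) = record
    { State = States v
    ; step  = λ s → pointMasses (transitions v s) (transitions-distinct v s) (valid s)
    ; init  = start v
    }

  private
    J-lax : (v w : V) (f : States (proj₁ v) → States (proj₁ w)) →
      (∀ s y → massAt (map (map₁ (map₂ f)) (transitions (proj₁ v) s)) y
               ≤ massAt (transitions (proj₁ w) (f s)) y) →
      ∀ s a y → weight (F-map f (step (J v) s)) (a , y) ≤ weight (step (J w) (f s)) (a , y)
    J-lax (v , vv) w f p s a y = ≤-trans
      (𝒟≤1-map-pointMasses (map₂ f) (transitions v s) (transitions-distinct v s) (vv s) (a , y))
      (p s (a , y))

  -- Morphisms do not depend on the validity proofs. The shared w and b of
  -- source and target are required to be the same representatives (≡ rather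
  -- than ≈ weights); V then contains duplicates of each word and triple, one
  -- for each choice of representatives, which does not affect openness.
  data EHom : Shape → Shape → Set where
    idE : ∀ {v} → EHom v v
    ext : ∀ {n} {w : Vec (A × ℝ⁺) n} {b m} {l : Vec ℝ⁺ (suc m)} → EHom (word w) (fork w b l)

  _∘E_ : ∀ {u v w} → EHom v w → EHom u v → EHom u w
  g   ∘E idE = g
  idE ∘E ext = ext

  data SHom : Shape → Shape → Set where
    idS   : ∀ {n} {w : Vec (A × ℝ⁺) n} → SHom (word w) (word w)
    merge : ∀ {n} {w : Vec (A × ℝ⁺) n} {b m′ m} {l′ : Vec ℝ⁺ (suc m′)} {l : Vec ℝ⁺ (suc m)}
      (s : Fin (suc m′) → Fin (suc m)) →
      (∀ {i j} → i Fin.≤ j → s i Fin.≤ s j) →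
      (∀ i → ∃ λ j → s j ≡ i) →
      (∀ i → value (lookup l i) ≈ ∑[ allFin (suc m′) ∣ (λ j → s j ≡ i) ] (λ j → value (lookup l′ j))) →
      SHom (fork w b l′) (fork w b l)

  SHom-id : ∀ v → SHom v v
  SHom-id (word w)           = idS
  SHom-id (fork w b {m} l) = merge id id (λ i → i , refl) λ i → ≤-antisym
    (∑∣-∈ (allFin (suc m)) (_≡ i) (λ j → value≥0 (lookup l j)) (∈-allFin i) refl)
    (∑∣-single (Unique.allFin⁺ (suc m)) (λ j → value≥0 (lookup l j)) i)

  _∘S_ : ∀ {u v w} → SHom v w → SHom u v → SHom u w
  g ∘S idS = g
  merge {m′ = m′} {l′ = l′} {l} t t-mono t-onto t-sum
    ∘S merge {m′ = m″} {l′ = l″} s s-mono s-onto s-sum = merge (t ∘ s) (t-mono ∘ s-mono) onto sum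
    where
    onto : ∀ i → ∃ λ k → t (s k) ≡ i
    onto i with t-onto i
    ... | j , tj≡i with s-onto j
    ... | k , sk≡j = k , trans (cong t sk≡j) tj≡i

    l″≥0 : ∀ k → 0ℝ ≤ value (lookup l″ k)
    l″≥0 k = value≥0 (lookup l″ k)

    sum : ∀ i → value (lookup l i) ≈
          ∑[ allFin (suc m″) ∣ (λ k → t (s k) ≡ i) ] (λ k → value (lookup l″ k))
    sum i = ≈-trans (t-sum i) (≈-trans
      (∑∣-cong (allFin (suc m′)) (λ j → t j ≡ i) s-sum)
      (≤-antisym
        (∑∣-from-fibres (allFin (suc m″)) (allFin (suc m′)) s (λ j → t j ≡ i) l″≥0
          (Unique.allFin⁺ (suc m′)))
        (∑∣-into-fibres (allFin (suc m″)) (allFin (suc m′)) s (λ j → t j ≡ i) l″≥0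
          (λ {k} _ → inj₁ (∈-allFin (s k))))))

  E-fun : ∀ {v w} → EHom v w → States v → States w
  E-fun idE = id
  E-fun ext = inj₁

  S-fun : ∀ {v w} → SHom v w → States v → States w
  S-fun idS             i        = i
  S-fun (merge s _ _ _) (inj₁ i) = inj₁ i
  S-fun (merge s _ _ _) (inj₂ j) = inj₂ (s j)

  -- S-fun determines the monotone surjection.
  _≈S_ : ∀ {v w} → SHom v w → SHom v w → Set
  g ≈S h = ∀ x → S-fun g x ≡ S-fun h x

  S-fun-id : ∀ v x → S-fun (SHom-id v) x ≡ x
  S-fun-id (word w)     i        = refl
  S-fun-id (fork w b l) (inj₁ i) = refl
  S-fun-id (fork w b l) (inj₂ j) = refl

  S-fun-∘ : ∀ {u v w} (g : SHom v w) (h : SHom u v) x → S-fun (g ∘S h) x ≡ S-fun g (S-fun h x)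
  S-fun-∘ g               idS             x        = refl
  S-fun-∘ (merge _ _ _ _) (merge _ _ _ _) (inj₁ i) = refl
  S-fun-∘ (merge _ _ _ _) (merge _ _ _ _) (inj₂ j) = refl

  J𝔼₁ : {v w : V} → EHom (proj₁ v) (proj₁ w) → LaxHom (J v) (J w)
  J𝔼₁ {v} {w} ϵ = record
    { fun = E-fun ϵ ; fun-init = start-pres ϵ ; lax = J-lax v w (E-fun ϵ) (mass ϵ) }
    where
    start-pres : ∀ {v w} (ϵ : EHom v w) → E-fun ϵ (start v) ≡ start w
    start-pres idE = refl
    start-pres ext = refl

    mass : ∀ {v w} (ϵ : EHom v w) s y →
           massAt (map (map₁ (map₂ (E-fun ϵ))) (transitions v s)) y
           ≤ massAt (transitions w (E-fun ϵ s)) y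
    mass {v} idE s y = ≈⇒≤ (≡⇒≈ (cong (λ L → massAt L y) (map-id (transitions v s))))
    mass (ext {b = b} {l = l}) i y with view i
    ... | ‵inject₁ _ = ≤-refl
    ... | ‵fromℕ     = massAt≥0 (map (leaf b l) (allFin _)) y

  J𝕊₁ : {v w : V} → SHom (proj₁ v) (proj₁ w) → LaxHom (J v) (J w)
  J𝕊₁ {v} {w} s = record
    { fun = S-fun s ; fun-init = start-pres s ; lax = J-lax v w (S-fun s) (mass s) }
    where
    start-pres : ∀ {v w} (s : SHom v w) → S-fun s (start v) ≡ start w
    start-pres idS             = refl
    start-pres (merge _ _ _ _) = refl

    mass : ∀ {v w} (s : SHom v w) x y →
           massAt (map (map₁ (map₂ (S-fun s))) (transitions v x)) y
           ≤ massAt (transitions w (S-fun s x)) y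
    mass {v} idS x y = ≈⇒≤ (≡⇒≈ (cong (λ L → massAt L y) (map-id (transitions v x))))
    mass (merge _ _ _ _) (inj₂ j) y = ≤-refl
    mass (merge {b = b} {m′} {m} {l′} {l} s s-mono s-onto s-sum) (inj₁ i) y with view i
    ... | ‵inject₁ _ = ≤-refl
    ... | ‵fromℕ     = begin
      massAt (map (map₁ (map₂ S-s)) (map (leaf b l′) (allFin (suc m′)))) y
        ≡⟨ ∑∣-map (map₁ (map₂ S-s)) (map (leaf b l′) (allFin (suc m′))) _ _ ⟩
      ∑[ map (leaf b l′) (allFin (suc m′)) ∣ (λ e → map₂ S-s (proj₁ e) ≡ y) ] (value ∘ proj₂)
        ≡⟨ ∑∣-map (leaf b l′) (allFin (suc m′)) _ _ ⟩
      ∑[ allFin (suc m′) ∣ (λ j → (b , inj₂ (s j)) ≡ y) ] (λ j → value (lookup l′ j))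
        ≤⟨ ∑∣-into-fibres (allFin (suc m′)) (allFin (suc m)) s (λ i → (b , inj₂ i) ≡ y)
             (λ j → value≥0 (lookup l′ j)) (λ {j} _ → inj₁ (∈-allFin (s j))) ⟩
      ∑[ allFin (suc m) ∣ (λ i → (b , inj₂ i) ≡ y) ]
        (λ i → ∑[ allFin (suc m′) ∣ (λ j → s j ≡ i) ] (λ j → value (lookup l′ j)))
        ≈⟨ ∑∣-cong (allFin (suc m)) _ s-sum ⟨
      ∑[ allFin (suc m) ∣ (λ i → (b , inj₂ i) ≡ y) ] (λ i → value (lookup l i))
        ≡⟨ ∑∣-map (leaf b l) (allFin (suc m)) _ _ ⟨
      massAt (map (leaf b l) (allFin (suc m))) y ∎
      where
      open ≤-Reasoning
      S-s = S-fun (merge s s-mono s-onto s-sum)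

  𝔼-𝒟 : Category V 0ℓ 0ℓ
  𝔼-𝒟 = record
    { Hom = λ v w → EHom (proj₁ v) (proj₁ w)
    ; _≋_ = _≡_
    ; ident = idE
    ; _⊚_ = _∘E_
    ; equiv = isEquivalence
    ; ⊚-cong = cong₂ _∘E_
    ; assoc = λ {_} {_} {_} {_} {f} {g} {h} → assocE f g h
    ; identityˡ = λ {_} {_} {f} → idˡ f
    ; identityʳ = refl
    }
    where
    assocE : ∀ {a b c d} (f : EHom c d) (g : EHom b c) (h : EHom a b) →
             ((f ∘E g) ∘E h) ≡ (f ∘E (g ∘E h))
    assocE f   g   idE = refl
    assocE idE idE ext = refl
    idˡ : ∀ {a b} (f : EHom a b) → (idE ∘E f) ≡ f
    idˡ idE = refl
    idˡ ext = refl

  𝕊-𝒟 : Category V 0ℓ 0ℓ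
  𝕊-𝒟 = record
    { Hom = λ v w → SHom (proj₁ v) (proj₁ w)
    ; _≋_ = _≈S_
    ; ident = λ {v} → SHom-id (proj₁ v)
    ; _⊚_ = _∘S_
    ; equiv = record
      { refl = λ _ → refl ; sym = λ p x → sym (p x) ; trans = λ p q x → trans (p x) (q x) }
    ; ⊚-cong = λ {_} {_} {_} {f} {f′} {g} {g′} p q x →
        trans (S-fun-∘ f g x)
          (trans (p (S-fun g x)) (trans (cong (S-fun f′) (q x)) (sym (S-fun-∘ f′ g′ x))))
    ; assoc = λ {_} {_} {_} {_} {f} {g} {h} x →
        trans (S-fun-∘ (f ∘S g) h x) (trans (S-fun-∘ f g (S-fun h x))
          (sym (trans (S-fun-∘ f (g ∘S h) x) (cong (S-fun f) (S-fun-∘ g h x)))))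
    ; identityˡ = λ {_} {b} {f} x → trans (S-fun-∘ (SHom-id _) f x) (S-fun-id _ (S-fun f x))
    ; identityʳ = λ {a} {_} {f} x → trans (S-fun-∘ f (SHom-id _) x) (cong (S-fun f) (S-fun-id _ x))
    }

  situation : OpenMapSituation LCoalg
  situation = record
    { V  = V
    ; J  = J
    ; 𝔼  = 𝔼-𝒟
    ; 𝕊  = 𝕊-𝒟
    ; J𝔼 = record
      { F₁ = λ {v} {w} → J𝔼₁ {v} {w}
      ; F₁-cong = λ { refl x → refl }
      ; identity = λ _ → refl
      ; homomorphism = λ {_} {_} {_} {f} {g} → E-fun-∘ f g
      }
    ; J𝕊 = record
      { F₁ = λ {v} {w} → J𝕊₁ {v} {w}
      ; F₁-cong = λ p → p
      ; identity = λ {v} → S-fun-id (proj₁ v)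
      ; homomorphism = λ {_} {_} {_} {f} {g} → S-fun-∘ f g
      }
    }
    where
    E-fun-∘ : ∀ {u v w} (g : EHom v w) (h : EHom u v) x →
              E-fun (g ∘E h) x ≡ E-fun g (E-fun h x)
    E-fun-∘ g   idE x = refl
    E-fun-∘ idE ext x = refl

  open OpenMapSituation situation public using (IsOpen; Bisimilar)

  IsReachable : (X : PointedCoalgebra) → State X → Set
  IsReachable X p =
    ∃ λ n → Σ (Vec (A × ℝ⁺) n) λ w → Σ (Valid (word w)) λ valid →
      Σ (LaxHom (J (word w , valid)) X) λ x → fun x (fromℕ n) ≡ p

  Reachable : PointedCoalgebra → Set
  Reachable X = ∀ p → IsReachable X p

{-# OPTIONS --safe #-}
module Submission where

-- If f is open and p is reachable along a word w, extend w by a single leaf that carries the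
-- whole weight of an a-transition f p → y. Openness splits this leaf into pieces sent to
-- a-successors of p over y, which therefore carry at least that weight: f is proper at p.
-- Conversely, if f is proper, the leaves of a fork over f p have to be split among the
-- successors of p without exceeding their weights. This is a transportation problem in each
-- fibre of f, and the greedy assignment solves it. Bisimilarity then follows by restricting
-- the mediating coalgebra to its reachable states, whose inclusion is a proper homomorphism.

open import Defs
open import Axiom.ExcludedMiddle using (ExcludedMiddle)
open import Data.Bool.Properties using (T-irrelevant)
open import Data.Empty using (⊥-elim)
open import Data.Fin.Base as Fin using (Fin; fromℕ; inject₁)
import Data.Fin.Properties as Fin
open import Data.Fin.Relation.Unary.Top
  using (View; ‵fromℕ; ‵inject₁; ‵inj₁; view; view-fromℕ; view-inject₁)
open import Data.List.Base using (List; []; _∷_; _++_; map; allFin; length)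
import Data.List.Base as List
open import Data.List.Membership.Propositional using (_∈_)
open import Data.List.Membership.Propositional.Properties
  using (∈-allFin; ∈-map⁺; ∈-lookup)
open import Data.List.Properties using (map-tabulate; tabulate-lookup)
open import Data.List.Relation.Unary.All as All using (All; []; _∷_)
import Data.List.Relation.Unary.All.Properties as All
open import Data.List.Relation.Unary.AllPairs using (AllPairs; []; _∷_)
import Data.List.Relation.Unary.AllPairs.Properties as AllPairs
open import Data.List.Relation.Unary.Any using (here; there)
open import Data.List.Relation.Unary.Unique.Propositional using (Unique)
import Data.List.Relation.Unary.Unique.Propositional.Properties as Unique
open import Data.Nat.Base as ℕ using (ℕ; suc)
import Data.Nat.Properties as ℕ
open import Data.Product using (Σ; ∃; _×_; _,_; proj₁; proj₂; map₁; map₂)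
open import Data.Rational.Base as ℚ using (0ℚ; ½; ∣_∣)
import Data.Rational.Properties as ℚ
open import Data.Rational.Solver using (module +-*-Solver)
open import Data.Sum.Base using (_⊎_; inj₁; inj₂; [_,_]′)
open import Data.Unit.Base using (⊤; tt)
open import Data.Vec.Base using (Vec; []; _∷_; _∷ʳ_; lookup; tabulate)
open import Data.Vec.Properties using (lookup∘tabulate)
open import Function.Base using (_∘_; _on_; id)
open import Function.Bundles using (_⇔_; mk⇔)
open import Level using (0ℓ)
open import Relation.Binary.Core using (Rel)
open import Relation.Binary.Definitions using (Reflexive)
open import Relation.Binary.PropositionalEquality
  using (_≡_; refl; sym; trans; cong; subst)
open import Relation.Nullary using (Dec; yes; no; ¬_)
open import Relation.Nullary.Decidable using (True; toWitness; fromWitness)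

private
  variable
    X Y Z : Set

-- Subtraction of reals

infixl 6 _-_

-_ : ℝ → ℝ
seq    (- x) n = ℚ.- seq x n
cauchy (- x) ε 0<ε = map₂
  (λ c m n m≥ n≥ → subst (ℚ._≤ ε) (sym (∣-∣-neg (seq x m) (seq x n))) (c m n m≥ n≥))
  (cauchy x ε 0<ε)
  where
  open +-*-Solver
  ∣-∣-neg : ∀ a b → ∣ ℚ.- a ℚ.- ℚ.- b ∣ ≡ ∣ a ℚ.- b ∣
  ∣-∣-neg a b = trans
    (cong ∣_∣ (solve 2 (λ a b → :- a :- :- b := :- (a :- b)) refl a b))
    (ℚ.∣-p∣≡∣p∣ (a ℚ.- b))

_-_ : ℝ → ℝ → ℝ
x - y = x + - y

+-comm : ∀ x y → x + y ≈ y + x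
+-comm x y = pointwise-≈ λ n → ℚ.+-comm (seq x n) (seq y n)

+-assoc : ∀ x y z → (x + y) + z ≈ x + (y + z)
+-assoc x y z = pointwise-≈ λ n → ℚ.+-assoc (seq x n) (seq y n) (seq z n)

x-y+y≈x : ∀ x y → (x - y) + y ≈ x
x-y+y≈x x y = pointwise-≈ λ n →
  solve 2 (λ a b → (a :+ :- b) :+ b := a) refl (seq x n) (seq y n)
  where open +-*-Solver

x+y-y≈x : ∀ x y → (x + y) - y ≈ x
x+y-y≈x x y = pointwise-≈ λ n →
  solve 2 (λ a b → (a :+ b) :+ :- b := a) refl (seq x n) (seq y n)
  where open +-*-Solver

+-cancelʳ-≤ : ∀ z {x y} → x + z ≤ y + z → x ≤ y
+-cancelʳ-≤ z {x} {y} p = begin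
  x            ≈⟨ x+y-y≈x x z ⟨
  (x + z) - z  ≤⟨ +-mono-≤ p ≤-refl ⟩
  (y + z) - z  ≈⟨ x+y-y≈x y z ⟩
  y            ∎
  where open ≤-Reasoning

x≤y⇒0≤y-x : ∀ {x y} → x ≤ y → 0ℝ ≤ y - x
x≤y⇒0≤y-x {x} {y} p = +-cancelʳ-≤ x (begin
  0ℝ + x       ≈⟨ +-identityˡ x ⟩
  x            ≤⟨ p ⟩
  y            ≈⟨ x-y+y≈x y x ⟨
  (y - x) + x  ∎)
  where open ≤-Reasoning

y-x≤0⇒y≤x : ∀ {x y} → y - x ≤ 0ℝ → y ≤ x
y-x≤0⇒y≤x {x} {y} p = begin
  y            ≈⟨ x-y+y≈x y x ⟨
  (y - x) + x  ≤⟨ +-mono-≤ p ≤-refl ⟩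
  0ℝ + x       ≈⟨ +-identityˡ x ⟩
  x            ∎
  where open ≤-Reasoning

≤+⇒-≤ : ∀ {x y z} → x ≤ y + z → x - y ≤ z
≤+⇒-≤ {x} {y} {z} p = +-cancelʳ-≤ y (begin
  (x - y) + y  ≈⟨ x-y+y≈x x y ⟩
  x            ≤⟨ p ⟩
  y + z        ≈⟨ +-comm y z ⟩
  z + y        ∎)
  where open ≤-Reasoning

x≤y+x : ∀ {x y} → 0ℝ ≤ y → x ≤ y + x
x≤y+x {x} p = ≤-trans (≈⇒≤ (≈-sym (+-identityˡ x))) (+-mono-≤ p ≤-refl)

-- Positivity of reals

private
  ½ε>0 : ∀ {ε} → 0ℚ ℚ.< ε → 0ℚ ℚ.< ε ℚ.* ½
  ½ε>0 {ε} 0<ε = subst (ℚ._< ε ℚ.* ½) (ℚ.*-zeroˡ ½) (ℚ.*-monoˡ-<-pos ½ 0<ε)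

  ½ε+½ε≡ε : ∀ ε → ε ℚ.* ½ ℚ.+ ε ℚ.* ½ ≡ ε
  ½ε+½ε≡ε ε = trans (sym (ℚ.*-distribˡ-+ ε ½ ½)) (ℚ.*-identityʳ ε)

  p≤∣p∣ : ∀ p → p ℚ.≤ ∣ p ∣
  p≤∣p∣ p with ℚ.≤-total 0ℚ p
  ... | inj₁ 0≤p = ℚ.≤-reflexive (sym (ℚ.0≤p⇒∣p∣≡p 0≤p))
  ... | inj₂ p≤0 = ℚ.≤-trans p≤0 (ℚ.0≤∣p∣ p)

  ∣p-q∣≤r⇒p≤q+r : ∀ {p q r} → ∣ p ℚ.- q ∣ ℚ.≤ r → p ℚ.≤ q ℚ.+ r
  ∣p-q∣≤r⇒p≤q+r {p} {q} {r} d = begin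
    p                ≡⟨ solve 2 (λ p q → p := q :+ (p :- q)) refl p q ⟩
    q ℚ.+ (p ℚ.- q)  ≤⟨ ℚ.+-monoʳ-≤ q (ℚ.≤-trans (p≤∣p∣ _) d) ⟩
    q ℚ.+ r          ∎
    where
    open ℚ.≤-Reasoning
    open +-*-Solver

-- The sequence is eventually at least the gap `δ`, but `x ≤ 0ℝ` taken at half of `δ` keeps it
-- eventually below that half.
0<x⇒x≰0 : ∀ {x} → 0ℝ < x → ¬ x ≤ 0ℝ
0<x⇒x≰0 {x} (mk< δ 0<δ (M , p)) x≤0 with below x≤0 _ (½ε>0 0<δ)
... | N , q = ℚ.<-irrefl refl (begin-strict
  δ                        ≡⟨ ℚ.+-identityˡ δ ⟨
  0ℚ ℚ.+ δ                 ≤⟨ p n (ℕ.m≤m⊔n M N) ⟩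
  seq x n                  ≤⟨ q n (ℕ.m≤n⊔m M N) ⟩
  0ℚ ℚ.+ δ ℚ.* ½           <⟨ ℚ.+-monoˡ-< (δ ℚ.* ½) (½ε>0 0<δ) ⟩
  δ ℚ.* ½ ℚ.+ δ ℚ.* ½      ≡⟨ ½ε+½ε≡ε δ ⟩
  δ                        ∎)
  where
  open ℚ.≤-Reasoning
  n = M ℕ.⊔ N

-- Only one rational is tested, at an index after which the sequence moves by at most half of `ε`.
-- If it is at most that half, the tail stays below `ε`; otherwise its excess is a gap witnessing
-- `0ℝ < x`.
0≮x⇒x≤0 : ∀ {x} → ¬ 0ℝ < x → x ≤ 0ℝ
0≮x⇒x≤0 {x} 0≮x .below ε 0<ε with cauchy x (ε ℚ.* ½) (½ε>0 0<ε)
... | N , c with seq x N ℚ.≤? ε ℚ.* ½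
... | yes small = N , λ n n≥ → begin
  seq x n                      ≤⟨ ∣p-q∣≤r⇒p≤q+r (c n N n≥ ℕ.≤-refl) ⟩
  seq x N ℚ.+ ε ℚ.* ½          ≤⟨ ℚ.+-monoˡ-≤ (ε ℚ.* ½) small ⟩
  ε ℚ.* ½ ℚ.+ ε ℚ.* ½          ≡⟨ ½ε+½ε≡ε ε ⟩
  ε                            ≡⟨ ℚ.+-identityˡ ε ⟨
  0ℚ ℚ.+ ε                     ∎
  where open ℚ.≤-Reasoning
... | no  large = ⊥-elim (0≮x (mk< (seq x N ℚ.- ε ℚ.* ½) gap>0′ (N , λ n n≥ → begin
  0ℚ ℚ.+ (seq x N ℚ.- ε ℚ.* ½)                   ≤⟨ ℚ.+-monoʳ-≤ 0ℚ (ℚ.+-monoˡ-≤ (ℚ.- (ε ℚ.* ½))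
                                                      (∣p-q∣≤r⇒p≤q+r {seq x N} {seq x n} (c N n ℕ.≤-refl n≥))) ⟩
  0ℚ ℚ.+ (seq x n ℚ.+ ε ℚ.* ½ ℚ.- ε ℚ.* ½)       ≡⟨ solve 2 (λ a b → con 0ℚ :+ (a :+ b :- b) := a)
                                                      refl (seq x n) (ε ℚ.* ½) ⟩
  seq x n                                        ∎)))
  where
  open ℚ.≤-Reasoning
  open +-*-Solver
  gap>0′ : 0ℚ ℚ.< seq x N ℚ.- ε ℚ.* ½
  gap>0′ = subst (ℚ._< seq x N ℚ.- ε ℚ.* ½) (ℚ.+-inverseʳ (ε ℚ.* ½))
    (ℚ.+-monoˡ-< (ℚ.- (ε ℚ.* ½)) (ℚ.≰⇒> large))

-- Finite sums

∑-++ : (xs ys : List X) (f : X → ℝ) → ∑ (xs ++ ys) f ≈ ∑ xs f + ∑ ys f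
∑-++ []       ys f = ≈-sym (+-identityˡ _)
∑-++ (x ∷ xs) ys f = ≈-trans (+-cong ≈-refl (∑-++ xs ys f)) (≈-sym (+-assoc (f x) _ _))

when-cong : {P : Set} (p : Dec P) {r s : ℝ} → r ≈ s → when p r ≈ when p s
when-cong (yes _) r≈s = r≈s
when-cong (no  _) r≈s = ≈-refl

when-+ : {P : Set} (p : Dec P) (r s : ℝ) → when p r + when p s ≈ when p (r + s)
when-+ (yes _) r s = ≈-refl
when-+ (no  _) r s = +-identityˡ 0ℝ

when-→ : {P Q : Set} (p : Dec P) (q : Dec Q) {r : ℝ} → 0ℝ ≤ r → (P → Q) → when p r ≤ when q r
when-→ (yes p) q r≥0 P→Q = when-yes q (P→Q p)
when-→ (no  _) q r≥0 P→Q = when-≥0 q r≥0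

module _ {R : Rel X 0ℓ} (R-refl : Reflexive R) where

  -- `AllPairs` relates each entry to the later ones only, so equal positions need reflexivity.
  lookup-mono : ∀ {xs} → AllPairs R xs →
                ∀ {i j} → i Fin.≤ j → R (List.lookup xs i) (List.lookup xs j)
  lookup-mono (_   ∷ _)  {Fin.zero}  {Fin.zero}  _         = R-refl
  lookup-mono {x ∷ xs} (Rx ∷ _)  {Fin.zero}  {Fin.suc j} _ = All.lookup Rx (∈-lookup {xs = xs} j)
  lookup-mono (_   ∷ Rs) {Fin.suc i} {Fin.suc j} (ℕ.s≤s p) = lookup-mono Rs p

-- Conditional sums and images of subdistributions

module Sums (em : ExcludedMiddle 0ℓ) where

  open Subdistributions em

  -- Labels of shapes are positive reals, so a weight or a remainder has to pass this test before it
  -- can become an `ℝ⁺`.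
  0<x⊎x≤0 : ∀ x → 0ℝ < x ⊎ x ≤ 0ℝ
  0<x⊎x≤0 x with em {0ℝ < x}
  ... | yes 0<x = inj₁ 0<x
  ... | no  0≮x = inj₂ (0≮x⇒x≤0 0≮x)

  ∑∣-∷ : ∀ x (xs : List X) (P : X → Set) (f : X → ℝ) →
         ∑[ x ∷ xs ∣ P ] f ≈ when (em {P x}) (f x) + ∑[ xs ∣ P ] f
  ∑∣-∷ x xs P f with em {P x}
  ... | yes _ = ≈-refl
  ... | no  _ = ≈-sym (+-identityˡ _)

  ∑∣-++ : (xs ys : List X) (P : X → Set) (f : X → ℝ) →
          ∑[ xs ++ ys ∣ P ] f ≈ ∑[ xs ∣ P ] f + ∑[ ys ∣ P ] f
  ∑∣-++ xs ys P f = begin-equality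
    ∑[ xs ++ ys ∣ P ] f                ≈⟨ ∑-filter (xs ++ ys) P f ⟩
    ∑ (xs ++ ys) _                     ≈⟨ ∑-++ xs ys _ ⟩
    ∑ xs _ + ∑ ys _                    ≈⟨ +-cong (∑-filter xs P f) (∑-filter ys P f) ⟨
    ∑[ xs ∣ P ] f + ∑[ ys ∣ P ] f      ∎
    where open ≤-Reasoning

  ∑∣-const : (xs : List X) (B : Set) (f : X → ℝ) → ∑[ xs ∣ (λ _ → B) ] f ≈ when (em {B}) (∑ xs f)
  ∑∣-const xs B f = ≈-trans (∑-filter xs (λ _ → B) f) (≈-sym (when-∑ (em {B}) xs f))

  ∑∣-⊆ : (xs : List X) {P Q : X → Set} {f : X → ℝ} → (∀ x → 0ℝ ≤ f x) →
         (∀ {x} → x ∈ xs → P x → Q x) → ∑[ xs ∣ P ] f ≤ ∑[ xs ∣ Q ] f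
  ∑∣-⊆ xs {P} {Q} {f} f≥0 P⊆Q = begin
    ∑[ xs ∣ P ] f                        ≈⟨ ∑-filter xs P f ⟩
    ∑ xs (λ x → when (em {P x}) (f x))   ≤⟨ ∑-mono xs (λ {x} x∈ →
                                              when-→ (em {P x}) (em {Q x}) (f≥0 x) (P⊆Q x∈)) ⟩
    ∑ xs (λ x → when (em {Q x}) (f x))   ≈⟨ ∑-filter xs Q f ⟨
    ∑[ xs ∣ Q ] f                        ∎
    where open ≤-Reasoning

  ∑∣-[-]-≤ : ∀ x (P : X → Set) (f : X → ℝ) {r} → (P x → f x ≤ r) → 0ℝ ≤ r →
             ∑[ x ∷ [] ∣ P ] f ≤ r
  ∑∣-[-]-≤ x P f fx≤r 0≤r with em {P x}
  ... | yes px = ≤-trans (≈⇒≤ (+-identityʳ (f x))) (fx≤r px)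
  ... | no  _  = 0≤r

  -- Transport plans are lists, whereas the leaves of a fork are indexed by `Fin`; this moves sums
  -- between the two.
  ∑∣-lookup : (xs : List X) (P : X → Set) (f : X → ℝ) →
              ∑[ allFin (length xs) ∣ P ∘ List.lookup xs ] (f ∘ List.lookup xs) ≡ ∑[ xs ∣ P ] f
  ∑∣-lookup xs P f = trans
    (sym (∑∣-map (List.lookup xs) (allFin (length xs)) P f))
    (cong (λ ys → ∑[ ys ∣ P ] f) (trans (map-tabulate id (List.lookup xs)) (tabulate-lookup xs)))

  -- One half is the lax version. For the other, `support ν` has no duplicates, so summing over its
  -- fibres counts each point of `support μ` at most once.
  𝒟≤1-map-∘-≈ : (φ : X → Y) (ψ : Y → Z) (μ : 𝒟≤1 X) (ν : 𝒟≤1 Y) →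
                (∀ y → 𝒟≤1-map φ μ .weight y ≈ ν .weight y) →
                ∀ z → 𝒟≤1-map (ψ ∘ φ) μ .weight z ≈ 𝒟≤1-map ψ ν .weight z
  𝒟≤1-map-∘-≈ φ ψ μ ν φμ≈ν z = ≤-antisym
    (𝒟≤1-map-∘ φ ψ μ ν (λ y → ≈⇒≤ (φμ≈ν y)) z)
    (begin
      ∑[ support ν ∣ (λ y → ψ y ≡ z) ] (weight ν)
        ≈⟨ ∑∣-cong (support ν) (λ y → ψ y ≡ z) φμ≈ν ⟨
      ∑[ support ν ∣ (λ y → ψ y ≡ z) ] (λ y → ∑[ support μ ∣ (λ x → φ x ≡ y) ] (weight μ))
        ≤⟨ ∑∣-from-fibres (support μ) (support ν) φ (λ y → ψ y ≡ z) (nonneg μ) (distinct ν) ⟩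
      ∑[ support μ ∣ (λ x → ψ (φ x) ≡ z) ] (weight μ) ∎)
    where open ≤-Reasoning

  -- Converse to `𝒟≤1-map-pointMasses`: every entry of `L` lies over a point of the support, so no
  -- mass is lost.
  massAt≤𝒟≤1-map : (f : X → Y) (L : List (X × ℝ⁺))
    (uniq : Unique (map proj₁ L)) (total : ∑ (map proj₁ L) (massAt L) ≤ 1ℝ) →
    ∀ y → massAt (map (map₁ f) L) y ≤ 𝒟≤1-map f (pointMasses L uniq total) .weight y
  massAt≤𝒟≤1-map f L uniq total y = begin
    massAt (map (map₁ f) L) y
      ≡⟨ ∑∣-map (map₁ f) L (λ e → proj₁ e ≡ y) (value ∘ proj₂) ⟩
    ∑[ L ∣ (λ e → f (proj₁ e) ≡ y) ] (value ∘ proj₂)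
      ≤⟨ ∑∣-into-fibres L (map proj₁ L) proj₁ (λ x → f x ≡ y) (λ e → value≥0 (proj₂ e))
           (λ e∈ → inj₁ (∈-map⁺ proj₁ e∈)) ⟩
    ∑[ map proj₁ L ∣ (λ x → f x ≡ y) ] (massAt L) ∎
    where
    open ≤-Reasoning

  -- Pushing forward along `f` keeps the total mass, and the image is dominated by `μ`. Entries sent
  -- outside `support μ` have weight zero, being bounded by `μ` there.
  massAt-total≤1 : (f : X → Y) (L : List (X × ℝ⁺)) → Unique (map proj₁ L) → (μ : 𝒟≤1 Y) →
    (∀ y → massAt (map (map₁ f) L) y ≤ weight μ y) → ∑ (map proj₁ L) (massAt L) ≤ 1ℝ
  massAt-total≤1 f L uniq μ below-μ = begin
    ∑ (map proj₁ L) (massAt L)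
      ≈⟨ ∑-all (map proj₁ L) (λ _ → tt) (massAt L) ⟩
    ∑[ map proj₁ L ∣ (λ _ → ⊤) ] (massAt L)
      ≤⟨ ∑∣-from-fibres L (map proj₁ L) proj₁ (λ _ → ⊤) (λ e → value≥0 (proj₂ e)) uniq ⟩
    ∑[ L ∣ (λ _ → ⊤) ] (value ∘ proj₂)
      ≤⟨ ∑∣-into-fibres L (support μ) (f ∘ proj₁) (λ _ → ⊤) (λ e → value≥0 (proj₂ e)) covered ⟩
    ∑[ support μ ∣ (λ _ → ⊤) ] (λ y → ∑[ L ∣ (λ e → f (proj₁ e) ≡ y) ] (value ∘ proj₂))
      ≤⟨ ∑∣-mono (support μ) (λ _ → ⊤) (λ y → ≤-trans
           (≈⇒≤ (≡⇒≈ (sym (∑∣-map (map₁ f) L (λ e → proj₁ e ≡ y) (value ∘ proj₂)))))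
           (below-μ y)) ⟩
    ∑[ support μ ∣ (λ _ → ⊤) ] (weight μ)
      ≈⟨ ∑-all (support μ) (λ _ → tt) (weight μ) ⟨
    ∑ (support μ) (weight μ)
      ≤⟨ total≤1 μ ⟩
    1ℝ ∎
    where
    open ≤-Reasoning
    covered : ∀ {e} → e ∈ L → f (proj₁ e) ∈ support μ ⊎ value (proj₂ e) ≤ 0ℝ
    covered {e} e∈ with em {f (proj₁ e) ∈ support μ}
    ... | yes fe∈ = inj₁ fe∈
    ... | no  fe∉ = inj₂ (begin
      value (proj₂ e)
        ≤⟨ ∑∣-∈ L (λ e′ → f (proj₁ e′) ≡ f (proj₁ e)) (λ e′ → value≥0 (proj₂ e′)) e∈ refl ⟩
      ∑[ L ∣ (λ e′ → f (proj₁ e′) ≡ f (proj₁ e)) ] (value ∘ proj₂)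
        ≡⟨ ∑∣-map (map₁ f) L (λ e′ → proj₁ e′ ≡ f (proj₁ e)) (value ∘ proj₂) ⟨
      massAt (map (map₁ f) L) (f (proj₁ e))
        ≤⟨ below-μ (f (proj₁ e)) ⟩
      weight μ (f (proj₁ e))
        ≈⟨ vanishes μ fe∉ ⟩
      0ℝ ∎)

-- The greedy solution of the transportation problem

-- Residual capacities are kept as a list, so that one balance equation, stated for every
-- predicate on points, accounts for single points and for whole fibres alike.
module Transport (em : ExcludedMiddle 0ℓ) where

  open Subdistributions em
  open Sums em

  Capacities : Set → Set
  Capacities X = List (X × Σ ℝ (0ℝ ≤_))

  Pieces : Set → Set
  Pieces X = List (X × ℝ⁺)

  available : Capacities X → (X → Set) → ℝ
  available cs Q = ∑[ cs ∣ Q ∘ proj₁ ] (proj₁ ∘ proj₂)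

  allotted : Pieces X → (X → Set) → ℝ
  allotted ps Q = ∑[ ps ∣ Q ∘ proj₁ ] (value ∘ proj₂)

  available≥0 : (cs : Capacities X) (Q : X → Set) → 0ℝ ≤ available cs Q
  available≥0 cs Q = ∑∣-≥0 cs (Q ∘ proj₁) (proj₂ ∘ proj₂)

  record Withdrawal {X : Set} (P : X → Set) (r : ℝ) (caps : Capacities X) : Set₁ where
    field
      pieces   : Pieces X
      residual : Capacities X
      within   : All (P ∘ proj₁) pieces
      total    : ∑ pieces (value ∘ proj₂) ≈ r
      balance  : ∀ Q → available residual Q + allotted pieces Q ≈ available caps Q

  open Withdrawal

  private
    skip : ∀ {P : X → Set} {r caps} c → Withdrawal P r caps → Withdrawal P r (c ∷ caps)
    skip c w .pieces   = w .pieces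
    skip c w .residual = c ∷ w .residual
    skip c w .within   = w .within
    skip c w .total    = w .total
    skip {caps = caps} c w .balance Q = begin-equality
      available (c ∷ residual w) Q + allotted (pieces w) Q
        ≈⟨ +-cong (∑∣-∷ c (residual w) (Q ∘ proj₁) _) ≈-refl ⟩
      (when q (proj₁ (proj₂ c)) + available (residual w) Q) + allotted (pieces w) Q
        ≈⟨ +-assoc _ _ _ ⟩
      when q (proj₁ (proj₂ c)) + (available (residual w) Q + allotted (pieces w) Q)
        ≈⟨ +-cong ≈-refl (balance w Q) ⟩
      when q (proj₁ (proj₂ c)) + available caps Q
        ≈⟨ ∑∣-∷ c caps (Q ∘ proj₁) _ ⟨
      available (c ∷ caps) Q ∎
      where
      open ≤-Reasoning
      q = em {Q (proj₁ c)}

    finish : ∀ {P : X → Set} {x caps} (k : ℝ⁺) c → P x → value k ≤ proj₁ c →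
             Withdrawal P (value k) ((x , c) ∷ caps)
    finish {x = x} k c px k≤c .pieces = (x , k) ∷ []
    finish {x = x} {caps} k c px k≤c .residual = (x , proj₁ c - value k , x≤y⇒0≤y-x k≤c) ∷ caps
    finish k c px k≤c .within = px ∷ []
    finish k c px k≤c .total  = +-identityʳ (value k)
    finish {x = x} {caps} k (c , c≥0) px k≤c .balance Q = begin-equality
      available ((x , c - value k , _) ∷ caps) Q + allotted ((x , k) ∷ []) Q
        ≈⟨ +-cong (∑∣-∷ _ caps (Q ∘ proj₁) _) (∑∣-∷ (x , k) [] (Q ∘ proj₁) _) ⟩
      (when q (c - value k) + available caps Q) + (when q (value k) + 0ℝ)
        ≈⟨ +-interchange _ _ _ _ ⟩
      (when q (c - value k) + when q (value k)) + (available caps Q + 0ℝ)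
        ≈⟨ +-cong (≈-trans (when-+ q _ _) (when-cong q (x-y+y≈x c (value k)))) (+-identityʳ _) ⟩
      when q c + available caps Q
        ≈⟨ ∑∣-∷ (x , c , c≥0) caps (Q ∘ proj₁) _ ⟨
      available ((x , c , c≥0) ∷ caps) Q ∎
      where
      open ≤-Reasoning
      q = em {Q x}

    exhaust : ∀ {P : X → Set} {x r caps} c → P x → 0ℝ < proj₁ c →
              Withdrawal P (r - proj₁ c) caps → Withdrawal P r ((x , c) ∷ caps)
    exhaust {x = x} c px 0<c w .pieces =
      (x , record { value = proj₁ c ; positive = 0<c }) ∷ w .pieces
    -- The emptied point is dropped, since a capacity of zero would contribute nothing.
    exhaust c px 0<c w .residual = w .residual
    exhaust c px 0<c w .within   = px ∷ w .within
    exhaust {r = r} c px 0<c w .total =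
      ≈-trans (+-comm (proj₁ c) _) (≈-trans (+-cong (w .total) ≈-refl) (x-y+y≈x r (proj₁ c)))
    exhaust {x = x} {caps = caps} (c , c≥0) px 0<c w .balance Q = begin-equality
      available (residual w) Q + allotted (e ∷ pieces w) Q
        ≈⟨ +-cong ≈-refl (∑∣-∷ e (pieces w) (Q ∘ proj₁) _) ⟩
      available (residual w) Q + (when q c + allotted (pieces w) Q)
        ≈⟨ +-comm _ _ ⟩
      (when q c + allotted (pieces w) Q) + available (residual w) Q
        ≈⟨ +-assoc _ _ _ ⟩
      when q c + (allotted (pieces w) Q + available (residual w) Q)
        ≈⟨ +-cong ≈-refl (≈-trans (+-comm _ _) (balance w Q)) ⟩
      when q c + available caps Q
        ≈⟨ ∑∣-∷ (x , c , c≥0) caps (Q ∘ proj₁) _ ⟨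
      available ((x , c , c≥0) ∷ caps) Q ∎
      where
      open ≤-Reasoning
      q = em {Q x}
      e = x , record { value = c ; positive = 0<c }

  -- Points of `P` are emptied in turn until one covers what is left of the demand. The capacities
  -- cannot run out first: an empty list offers zero, while the outstanding demand is positive.
  withdraw : (P : X → Set) (caps : Capacities X) (k : ℝ⁺) → value k ≤ available caps P →
             Withdrawal P (value k) caps
  withdraw P [] k k≤ = ⊥-elim (0<x⇒x≰0 (positive k) k≤)
  withdraw P ((x , c , c≥0) ∷ caps) k k≤ with em {P x}
  ... | no  _  = skip (x , c , c≥0) (withdraw P caps k k≤)
  ... | yes px with 0<x⊎x≤0 c
  -- A point of capacity zero yields no piece, as pieces have positive amounts; passing over it
  -- loses nothing.
  ... | inj₂ c≤0 = skip (x , c , c≥0) (withdraw P caps k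
    (≤-trans k≤ (≤-trans (+-mono-≤ c≤0 ≤-refl) (≈⇒≤ (+-identityˡ _)))))
  ... | inj₁ 0<c with 0<x⊎x≤0 (value k - c)
  ... | inj₂ k-c≤0 = finish k (c , c≥0) px (y-x≤0⇒y≤x k-c≤0)
  ... | inj₁ 0<k-c = exhaust (c , c≥0) px 0<c
    (withdraw P caps (record { value = value k - c ; positive = 0<k-c }) (≤+⇒-≤ k≤))

  module _ {I X Y : Set} (demand : I → ℝ⁺) (target : I → Y) (f : X → Y) where

    record Piece : Set where
      constructor piece
      field
        tag    : I
        point  : X
        amount : ℝ⁺

    open Piece public

    fromWithdrawal : I → X × ℝ⁺ → Piece
    fromWithdrawal i (x , k) = piece i x k

    -- Tags name the demand that a piece serves. `sorted` later makes the map from pieces to leaves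
    -- monotone, and `tagged` keeps it provable when blocks are concatenated.
    record Plan (R : Rel I 0ℓ) (is : List I) (caps : Capacities X) : Set where
      field
        plan     : List Piece
        capacity : ∀ x → ∑[ plan ∣ (λ e → point e ≡ x) ] (value ∘ amount) ≤ available caps (_≡ x)
        matched  : All (λ e → f (point e) ≡ target (tag e)) plan
        met      : ∀ i → ∑[ plan ∣ (λ e → tag e ≡ i) ] (value ∘ amount)
                         ≈ ∑[ is ∣ _≡ i ] (value ∘ demand)
        tagged   : All (λ e → tag e ∈ is) plan
        sorted   : AllPairs (R on tag) plan

    open Plan

    -- Demands are served one by one, each from the fibre over its own target. Feasibility is
    -- required fibre by fibre, and it survives because serving `i` lowers the capacity of that
    -- fibre by at most the demand of `i` and leaves the other fibres alone.
    distribute : ∀ {R} → Reflexive R → ∀ {is} → AllPairs R is → (caps : Capacities X) →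
      (∀ y → ∑[ is ∣ (λ i → target i ≡ y) ] (value ∘ demand) ≤ available caps (λ x → f x ≡ y)) →
      Plan R is caps
    distribute R-refl [] caps feasible = record
      { plan = [] ; capacity = λ x → available≥0 caps (_≡ x)
      ; matched = [] ; met = λ _ → ≈-refl ; tagged = [] ; sorted = [] }
    distribute {R} R-refl {i ∷ is} (Ri ∷ Ris) caps feasible = record
      { plan     = block ++ plan rest
      ; capacity = λ x → begin
          ∑[ block ++ plan rest ∣ (λ e → point e ≡ x) ] (value ∘ amount)
            ≈⟨ ∑∣-++ block (plan rest) _ _ ⟩
          ∑[ block ∣ (λ e → point e ≡ x) ] (value ∘ amount)
            + ∑[ plan rest ∣ (λ e → point e ≡ x) ] (value ∘ amount)
            ≤⟨ +-mono-≤ (≈⇒≤ (≡⇒≈ (∑∣-map (fromWithdrawal i) (pieces w) _ _))) (capacity rest x) ⟩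
          allotted (pieces w) (_≡ x) + available (residual w) (_≡ x)
            ≈⟨ ≈-trans (+-comm _ _) (balance w (_≡ x)) ⟩
          available caps (_≡ x) ∎
      ; matched  = All.++⁺ (All.map⁺ (within w)) (matched rest)
      ; met      = λ j → begin-equality
          ∑[ block ++ plan rest ∣ (λ e → tag e ≡ j) ] (value ∘ amount)
            ≈⟨ ∑∣-++ block (plan rest) _ _ ⟩
          ∑[ block ∣ (λ e → tag e ≡ j) ] (value ∘ amount)
            + ∑[ plan rest ∣ (λ e → tag e ≡ j) ] (value ∘ amount)
            ≈⟨ +-cong (≡⇒≈ (∑∣-map (fromWithdrawal i) (pieces w) _ _)) (met rest j) ⟩
          ∑[ pieces w ∣ (λ _ → i ≡ j) ] (value ∘ proj₂) + ∑[ is ∣ _≡ j ] (value ∘ demand)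
            ≈⟨ +-cong (≈-trans (∑∣-const (pieces w) (i ≡ j) _) (when-cong (em {i ≡ j}) (total w))) ≈-refl ⟩
          when (em {i ≡ j}) (value (demand i)) + ∑[ is ∣ _≡ j ] (value ∘ demand)
            ≈⟨ ∑∣-∷ i is (_≡ j) _ ⟨
          ∑[ i ∷ is ∣ _≡ j ] (value ∘ demand) ∎
      ; tagged   = All.++⁺ (All.map⁺ (All.universal (λ _ → here refl) (pieces w)))
                           (All.map there (tagged rest))
      ; sorted   = AllPairs.++⁺ (AllPairs.map⁺ (diagonal (pieces w))) (sorted rest)
          (All.map⁺ (All.universal (λ _ → All.map (All.lookup Ri) (tagged rest)) (pieces w)))
      }
      where
      open ≤-Reasoning

      w : Withdrawal (λ x → f x ≡ target i) (value (demand i)) caps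
      -- The demand of `i` is one summand of the total demand on its fibre.
      w = withdraw _ caps (demand i) (≤-trans
        (∑∣-∈ (i ∷ is) (λ j → target j ≡ target i) (value≥0 ∘ demand) (here refl) refl)
        (feasible (target i)))

      block : List Piece
      block = map (fromWithdrawal i) (pieces w)

      diagonal : (ps : Pieces X) → AllPairs (λ _ _ → R i i) ps
      diagonal []       = []
      diagonal (p ∷ ps) = All.universal (λ _ → R-refl) ps ∷ diagonal ps

      -- All pieces lie over `target i`, so a fibre receives either the whole demand or nothing.
      allotted-fibre : ∀ y →
        allotted (pieces w) (λ x → f x ≡ y) ≤ when (em {target i ≡ y}) (value (demand i))
      allotted-fibre y = begin
        allotted (pieces w) (λ x → f x ≡ y)
          ≤⟨ ∑∣-⊆ (pieces w) (λ e → value≥0 (proj₂ e))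
               (λ e∈ fe≡y → trans (sym (All.lookup (within w) e∈)) fe≡y) ⟩
        ∑[ pieces w ∣ (λ _ → target i ≡ y) ] (value ∘ proj₂)
          ≈⟨ ∑∣-const (pieces w) (target i ≡ y) _ ⟩
        when (em {target i ≡ y}) (∑ (pieces w) (value ∘ proj₂))
          ≈⟨ when-cong (em {target i ≡ y}) (total w) ⟩
        when (em {target i ≡ y}) (value (demand i)) ∎

      rest : Plan R is (residual w)
      -- Adding the demand of `i`, if it targets `y`, to both sides reduces the claim to
      -- `feasible y`.
      rest = distribute R-refl Ris (residual w) λ y →
        +-cancelʳ-≤ (when (em {target i ≡ y}) (value (demand i))) (begin
          ∑[ is ∣ (λ j → target j ≡ y) ] (value ∘ demand) + when (em {target i ≡ y}) (value (demand i))
            ≈⟨ ≈-trans (+-comm _ _) (≈-sym (∑∣-∷ i is (λ j → target j ≡ y) _)) ⟩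
          ∑[ i ∷ is ∣ (λ j → target j ≡ y) ] (value ∘ demand)
            ≤⟨ feasible y ⟩
          available caps (λ x → f x ≡ y)
            ≈⟨ balance w (λ x → f x ≡ y) ⟨
          available (residual w) (λ x → f x ≡ y) + allotted (pieces w) (λ x → f x ≡ y)
            ≤⟨ +-mono-≤ ≤-refl (allotted-fibre y) ⟩
          available (residual w) (λ x → f x ≡ y) + when (em {target i ≡ y}) (value (demand i)) ∎)

-- Restriction of a subdistribution along an injection

module Pullback (em : ExcludedMiddle 0ℓ) {W X : Set}
  (ι : W → X) (ι-injective : ∀ {w w′} → ι w ≡ ι w′ → w ≡ w′) where

  open Subdistributions em
  open Sums em

  preimages : List X → List W
  preimages []       = []
  preimages (x ∷ xs) with em {∃ λ w → ι w ≡ x}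
  ... | yes (w , _) = w ∷ preimages xs
  ... | no  _       = preimages xs

  ∈-preimages⁺ : ∀ {w xs} → ι w ∈ xs → w ∈ preimages xs
  ∈-preimages⁺ {w} {x ∷ xs} ιw∈ with em {∃ λ w → ι w ≡ x} | ιw∈
  ... | yes (w′ , ιw′≡x) | here ιw≡x  = here (ι-injective (trans ιw≡x (sym ιw′≡x)))
  ... | yes _            | there ιw∈′ = there (∈-preimages⁺ ιw∈′)
  ... | no  ∄w           | here ιw≡x  = ⊥-elim (∄w (w , ιw≡x))
  ... | no  _            | there ιw∈′ = ∈-preimages⁺ ιw∈′

  ∈-preimages⁻ : ∀ {w} xs → w ∈ preimages xs → ι w ∈ xs
  ∈-preimages⁻ (x ∷ xs) w∈ with em {∃ λ w → ι w ≡ x} | w∈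
  ... | yes (_ , ιw≡x) | here refl = here ιw≡x
  ... | yes _          | there w∈′ = there (∈-preimages⁻ xs w∈′)
  ... | no  _          | w∈′       = there (∈-preimages⁻ xs w∈′)

  preimages-unique : ∀ {xs} → Unique xs → Unique (preimages xs)
  preimages-unique []                  = []
  preimages-unique {x ∷ xs} (x∉ ∷ uniq) with em {∃ λ w → ι w ≡ x}
  ... | yes (_ , refl) =
    All.tabulate (λ w∈ w≡ → All.lookup x∉ (∈-preimages⁻ xs w∈) (cong ι w≡)) ∷ preimages-unique uniq
  ... | no  _          = preimages-unique uniq

  ∑-preimages : {f : X → ℝ} → (∀ x → 0ℝ ≤ f x) → ∀ xs → ∑ (preimages xs) (f ∘ ι) ≤ ∑ xs f
  ∑-preimages f≥0 []       = ≤-refl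
  ∑-preimages f≥0 (x ∷ xs) with em {∃ λ w → ι w ≡ x}
  ... | yes (_ , refl) = +-mono-≤ ≤-refl (∑-preimages f≥0 xs)
  ... | no  _          = ≤-trans (∑-preimages f≥0 xs) (x≤y+x (f≥0 x))

  pullback : 𝒟≤1 X → 𝒟≤1 W
  pullback μ = record
    { weight   = weight μ ∘ ι
    ; support  = preimages (support μ)
    ; distinct = preimages-unique (distinct μ)
    ; vanishes = λ w∉ → vanishes μ (w∉ ∘ ∈-preimages⁺)
    ; nonneg   = nonneg μ ∘ ι
    ; total≤1  = ≤-trans (∑-preimages (nonneg μ) (support μ)) (total≤1 μ)
    }

  -- By injectivity the fibre over a point of the image is a singleton. Elsewhere the fibre is
  -- empty, and `μ` is assumed to vanish.
  map-pullback : (μ : 𝒟≤1 X) → (∀ x → ¬ (∃ λ w → ι w ≡ x) → weight μ x ≈ 0ℝ) →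
                 ∀ x → 𝒟≤1-map ι (pullback μ) .weight x ≈ weight μ x
  map-pullback μ outside x with em {∃ λ w → ι w ≡ x}
  ... | no  ∄w         = ≈-trans
    (∑∣-∅ (preimages (support μ)) (λ w → ι w ≡ x) λ {w} _ ιw≡x → ∄w (w , ιw≡x))
    (≈-sym (outside x ∄w))
  ... | yes (w , refl) = ≤-antisym
    (≤-trans (∑∣-⊆ S (nonneg μ ∘ ι) (λ _ → ι-injective))
             (∑∣-single (preimages-unique (distinct μ)) (nonneg μ ∘ ι) w))
    lower
    where
    S = preimages (support μ)
    lower : weight μ (ι w) ≤ ∑[ S ∣ (λ w′ → ι w′ ≡ ι w) ] (weight μ ∘ ι)
    lower with em {w ∈ S}
    ... | yes w∈ = ∑∣-∈ S (λ w′ → ι w′ ≡ ι w) (nonneg μ ∘ ι) w∈ refl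
    ... | no  w∉ = ≤-trans (≈⇒≤ (vanishes μ (w∉ ∘ ∈-preimages⁺)))
                           (∑∣-≥0 S (λ w′ → ι w′ ≡ ι w) (nonneg μ ∘ ι))

-- Families and vectors with a new last entry

append : ∀ {n} → (Fin n → X) → X → Fin (suc n) → X
append {n = ℕ.zero} h q _           = q
append {n = suc n}  h q Fin.zero    = h Fin.zero
append {n = suc n}  h q (Fin.suc i) = append (h ∘ Fin.suc) q i

append-inject₁ : ∀ {n} (h : Fin n → X) q i → append h q (inject₁ i) ≡ h i
append-inject₁ h q Fin.zero    = refl
append-inject₁ h q (Fin.suc i) = append-inject₁ (h ∘ Fin.suc) q i

append-fromℕ : ∀ {n} (h : Fin n → X) q → append h q (fromℕ n) ≡ q
append-fromℕ {n = ℕ.zero} h q = refl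
append-fromℕ {n = suc n}  h q = append-fromℕ (h ∘ Fin.suc) q

lookup-∷ʳ-inject₁ : ∀ {n} (xs : Vec X n) x i → lookup (xs ∷ʳ x) (inject₁ i) ≡ lookup xs i
lookup-∷ʳ-inject₁ (_ ∷ _)  x Fin.zero    = refl
lookup-∷ʳ-inject₁ (_ ∷ xs) x (Fin.suc i) = lookup-∷ʳ-inject₁ xs x i

lookup-∷ʳ-fromℕ : ∀ {n} (xs : Vec X n) x → lookup (xs ∷ʳ x) (fromℕ n) ≡ x
lookup-∷ʳ-fromℕ []       x = refl
lookup-∷ʳ-fromℕ (_ ∷ xs) x = lookup-∷ʳ-fromℕ xs x

-- Lax homomorphisms out of words and forks

module Openness (em : ExcludedMiddle 0ℓ) (A : Set) where

  -- The applied module copies constructors, which defeats the syntactic comparison of types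
  -- LaxHom (J (word w , valid)) X; unfolding J instead is prohibitively slow.
  open Coalgebras em A hiding (word; fork)
  open Coalgebras using (word; fork)
  open Sums em
  open Transport em
  open Category LCoalg using (_⊚_)

  -- Laxness of `h` in terms of lists of point masses. It makes sense before `v` is known to be
  -- valid, and it implies validity.
  record Simulates (v : Shape) (X : PointedCoalgebra) (h : States v → State X) : Set where
    constructor mkSim
    field
      simulates : ∀ s z →
        massAt (map (map₁ (map₂ h)) (transitions v s)) z ≤ weight (step X (h s)) z

  open Simulates

  module _ {v : Shape} {X : PointedCoalgebra} {h : States v → State X} (sim : Simulates v X h) where

    simulates⇒valid : Valid v
    simulates⇒valid s = massAt-total≤1 (map₂ h) (transitions v s) (transitions-distinct v s)
      (step X (h s)) (simulates sim s)

    simulates⇒hom : h (start v) ≡ init X → LaxHom (J (v , simulates⇒valid)) X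
    simulates⇒hom start-pres = record
      { fun = h ; fun-init = start-pres
      ; lax = λ s a y → ≤-trans
          (𝒟≤1-map-pointMasses (map₂ h) (transitions v s) (transitions-distinct v s)
             (simulates⇒valid s) (a , y))
          (simulates sim s (a , y))
      }

  hom⇒simulates : ∀ {X} (v : V) (x : LaxHom (J v) X) → Simulates (proj₁ v) X (fun x)
  hom⇒simulates (v , valid) x = mkSim λ s (a , y) → ≤-trans
    (massAt≤𝒟≤1-map (map₂ (fun x)) (transitions v s) (transitions-distinct v s) (valid s) (a , y))
    (lax x s a y)

  massAt-leaves : ∀ {n} (w : Vec (A × ℝ⁺) n) b {m} (l : Vec ℝ⁺ (suc m)) {S : Set}
    (h : States (fork w b l) → S) z →
    massAt (map (map₁ (map₂ h)) (transitions (fork w b l) (inj₁ (fromℕ n)))) z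
    ≡ ∑[ allFin (suc m) ∣ (λ i → (b , h (inj₂ i)) ≡ z) ] (value ∘ lookup l)
  -- `transitions` reduces at the last spine state only once its view is known to be `‵fromℕ`.
  massAt-leaves {n} w b {m} l h z rewrite view-fromℕ n = trans
    (∑∣-map (map₁ (map₂ h)) (map (leaf b l) (allFin (suc m))) (λ e → proj₁ e ≡ z) (value ∘ proj₂))
    (∑∣-map (leaf b l) (allFin (suc m)) (λ e → map₂ h (proj₁ e) ≡ z) (value ∘ proj₂))

  -- An inner spine state keeps its only transition when the word is forked or prolonged, so this
  -- bound serves both constructions.
  spine-simulates : ∀ {X n} {w : Vec (A × ℝ⁺) n} {h} → Simulates (word w) X h → ∀ i z →
    massAt (map (map₁ (map₂ h)) (spine w i ∷ [])) z ≤ weight (step X (h (inject₁ i))) z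
  spine-simulates {X} {w = w} {h} sim i z =
    subst (λ v → massAt (map (map₁ (map₂ h)) (wordOut w v)) z ≤ weight (step X (h (inject₁ i))) z)
          (view-inject₁ i) (simulates sim (inject₁ i) z)

  -- Only the end of the word needs a new bound: inner states move as before, and leaves have no
  -- transitions.
  fork-simulates : ∀ {X n} {w : Vec (A × ℝ⁺) n} {b m} {l : Vec ℝ⁺ (suc m)} {h t} →
    Simulates (word w) X h →
    (∀ z → ∑[ allFin (suc m) ∣ (λ i → (b , t i) ≡ z) ] (value ∘ lookup l)
           ≤ weight (step X (h (fromℕ n))) z) →
    Simulates (fork w b l) X [ h , t ]′
  fork-simulates {X} {n} {w} {b} {l = l} {h} {t} sim leaves = mkSim λ where
      (inj₁ i) z → go (view i) refl z
      (inj₂ i) z → nonneg (step X (t i)) z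
    where
    go : ∀ {i} (v : View i) → view i ≡ v → ∀ z →
         massAt (map (map₁ (map₂ [ h , t ]′)) (transitions (fork w b l) (inj₁ i))) z
         ≤ weight (step X (h i)) z
    go (‵inject₁ i) eq z rewrite eq = spine-simulates sim i z
    go ‵fromℕ       eq z = ≤-trans (≈⇒≤ (≡⇒≈ (massAt-leaves w b l [ h , t ]′ z))) (leaves z)

  -- Open maps are proper at reachable states

  -- The only possible factorisation is `ext` followed by a `merge`. All leaves of `u` merge into
  -- the single leaf, so their weights add up to `k`, and `f` sends them all to `y`; laxness of `x`
  -- bounds their mass by that of the fibre over `y`.
  split-leaf-≤ : ∀ {X Y n} (f : LaxHom X Y) (w : Vec (A × ℝ⁺) n) {a k y} (h : Fin (suc n) → State X)
    (u : V) (ϵ : EHom (word w) (proj₁ u)) (s : SHom (proj₁ u) (fork w a (k ∷ [])))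
    (x : LaxHom (J u) X) → (∀ i → fun x (E-fun ϵ i) ≡ h i) →
    (∀ i → fun f (fun x i) ≡ [ fun f ∘ h , (λ _ → y) ]′ (S-fun s i)) →
    value k ≤ weight (F-map (fun f) (step X (h (fromℕ n)))) (a , y)
  split-leaf-≤ {X} {n = n} f w {a} {k} {y} h (fork _ _ {m} l , valid) ext (merge s _ _ s-sum)
    x extends lifts = begin
    value k
      ≈⟨ s-sum Fin.zero ⟩
    ∑[ allFin (suc m) ∣ (λ j → s j ≡ Fin.zero) ] (value ∘ lookup l)
      ≤⟨ ∑∣-⊆ (allFin (suc m)) (value≥0 ∘ lookup l) (λ {j} _ _ → cong (a ,_) (lifts (inj₂ j))) ⟩
    ∑[ allFin (suc m) ∣ (λ j → (a , fun f (fun x (inj₂ j))) ≡ (a , y)) ] (value ∘ lookup l)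
      ≡⟨ massAt-leaves w a l (fun f ∘ fun x) (a , y) ⟨
    massAt (map (map₁ (map₂ (fun f ∘ fun x))) (transitions (fork w a l) end)) (a , y)
      ≤⟨ massAt≤𝒟≤1-map (map₂ (fun f ∘ fun x)) (transitions (fork w a l) end)
           (transitions-distinct (fork w a l) end) (valid end) (a , y) ⟩
    weight (F-map (fun f ∘ fun x) μ) (a , y)
      ≤⟨ 𝒟≤1-map-∘ (map₂ (fun x)) (map₂ (fun f)) μ (step X (fun x end))
           (λ (b , q) → lax x end b q) (a , y) ⟩
    weight (F-map (fun f) (step X (fun x end))) (a , y)
      ≡⟨ cong (λ q → weight (F-map (fun f) (step X q)) (a , y)) (extends (fromℕ n)) ⟩
    weight (F-map (fun f) (step X (h (fromℕ n)))) (a , y) ∎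
    where
    open ≤-Reasoning
    end : States (fork w a l)
    end = inj₁ (fromℕ n)
    μ = step (J (fork w a l , valid)) end

  open⇒k≤ : ∀ {X Y n} (f : LaxHom X Y) → IsOpen {X} {Y} f →
    (w : Vec (A × ℝ⁺) n) (valid : Valid (word w)) (x : LaxHom (J (word w , valid)) X)
    (k : ℝ⁺) → ∀ a y → value k ≤ weight (step Y (fun f (fun x (fromℕ n)))) (a , y) →
    value k ≤ weight (F-map (fun f) (step X (fun x (fromℕ n)))) (a , y)
  open⇒k≤ {X} {Y} {n} f f-open w valid x k a y k≤ =
    let u , ϵ , s , x′ , _ , extends , lifts =
          f-open {word w , valid} {fork w a (k ∷ []) , simulates⇒valid sim} ext x
                 (simulates⇒hom sim (fun-init (f ⊚ x))) (λ _ → refl)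
    in split-leaf-≤ {X} {Y} f w {a} {k} {y} (fun x) u ϵ s x′ extends lifts
    where
    sim : Simulates (fork w a (k ∷ [])) Y [ fun f ∘ fun x , (λ _ → y) ]′
    sim = fork-simulates (hom⇒simulates (word w , valid) (f ⊚ x))
      -- The single leaf puts mass only on `(a , y)`, where `k≤` bounds it.
      λ z → ∑∣-[-]-≤ Fin.zero (λ _ → (a , y) ≡ z) (value ∘ lookup (k ∷ []))
              (λ { refl → k≤ }) (nonneg (step Y (fun f (fun x (fromℕ n)))) z)

  open⇒proper-at : ∀ {X Y} (f : LaxHom X Y) → IsOpen {X} {Y} f → ∀ {p} → IsReachable X p →
    ∀ a y → weight (F-map (fun f) (step X p)) (a , y) ≈ weight (step Y (fun f p)) (a , y)
  open⇒proper-at {X} {Y} f f-open {p} (n , w , valid , x , refl) a y =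
    ≤-antisym (lax f p a y) lower
    where
    lower : weight (step Y (fun f p)) (a , y) ≤ weight (F-map (fun f) (step X p)) (a , y)
    -- A leaf must have positive weight; for weight zero the bound is trivial.
    lower with 0<x⊎x≤0 (weight (step Y (fun f p)) (a , y))
    ... | inj₁ 0< = open⇒k≤ f f-open w valid x (record { positive = 0< }) a y ≤-refl
    ... | inj₂ ≤0 = ≤-trans ≤0 (nonneg (F-map (fun f) (step X p)) (a , y))

  -- Proper homomorphisms are open

  proper⇒open : ∀ {X Y} (f : LaxHom X Y) → IsProper {X} {Y} f → IsOpen {X} {Y} f
  proper⇒open f proper {v} idE x y commutes =
    v , idE , SHom-id (proj₁ v) , x , S-fun-id (proj₁ v) , (λ _ → refl) ,
    λ i → trans (sym (commutes i)) (cong (fun y) (sym (S-fun-id (proj₁ v) i)))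
  proper⇒open {X} {Y} f proper {_ , word-valid} {_ , fork-valid}
    (ext {n} {w} {b} {m} {l}) x y commutes = lift π
    where
    open ≤-Reasoning

    p = fun x (fromℕ n)
    μ = step X p

    target : Fin (suc m) → A × State Y
    target i = b , fun y (inj₂ i)

    caps : Capacities (A × State X)
    caps = map (λ z → z , weight μ z , nonneg μ z) (support μ)

    available-caps : ∀ Q → available caps Q ≡ ∑[ support μ ∣ Q ] (weight μ)
    available-caps Q = ∑∣-map (λ z → z , weight μ z , nonneg μ z) (support μ) (Q ∘ proj₁) (proj₁ ∘ proj₂)

    -- Laxness of `y` bounds the leaves over `z` by the weight in `Y`; the commuting square moves
    -- this weight to `fun f p`, where properness equates it with the mass of the fibre in `X`.
    feasible : ∀ z → ∑[ allFin (suc m) ∣ (λ i → target i ≡ z) ] (value ∘ lookup l)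
                     ≤ available caps (λ q → map₂ (fun f) q ≡ z)
    feasible z = begin
      ∑[ allFin (suc m) ∣ (λ i → target i ≡ z) ] (value ∘ lookup l)
        ≡⟨ massAt-leaves w b l (fun y) z ⟨
      massAt (map (map₁ (map₂ (fun y))) (transitions (fork w b l) (inj₁ (fromℕ n)))) z
        ≤⟨ simulates (hom⇒simulates (fork w b l , fork-valid) y) (inj₁ (fromℕ n)) z ⟩
      weight (step Y (fun y (inj₁ (fromℕ n)))) z
        ≡⟨ cong (λ q → weight (step Y q) z) (commutes (fromℕ n)) ⟩
      weight (step Y (fun f p)) z
        ≈⟨ proper p (proj₁ z) (proj₂ z) ⟨
      weight (F-map (fun f) μ) z
        ≡⟨ available-caps (λ q → map₂ (fun f) q ≡ z) ⟨
      available caps (λ q → map₂ (fun f) q ≡ z) ∎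

    demand-once : ∀ i → value (lookup l i) ≈ ∑[ allFin (suc m) ∣ _≡ i ] (value ∘ lookup l)
    demand-once i = ≤-antisym
      (∑∣-∈ (allFin (suc m)) (_≡ i) (value≥0 ∘ lookup l) (∈-allFin i) refl)
      (∑∣-single (Unique.allFin⁺ (suc m)) (value≥0 ∘ lookup l) i)

    π : Plan (lookup l) target (map₂ (fun f)) Fin._≤_ (allFin (suc m)) caps
    -- `allFin` is increasing, so the pieces come out ordered by leaf.
    π = distribute (lookup l) target (map₂ (fun f)) Fin.≤-refl
          (AllPairs.tabulate⁺-< ℕ.<⇒≤) caps feasible

    lift : Plan (lookup l) target (map₂ (fun f)) Fin._≤_ (allFin (suc m)) caps → _
    -- A fork has at least one leaf, so the plan must not be empty: an empty one would leave the
    -- positive demand of leaf zero unmet.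
    lift record { plan = [] ; met = met } = ⊥-elim (0<x⇒x≰0 (positive (lookup l Fin.zero))
      (≈⇒≤ (≈-trans (demand-once Fin.zero) (≈-sym (met Fin.zero)))))
    lift record { plan = e ∷ es ; capacity = capacity ; matched = matched ; met = met ; sorted = sorted } =
      (fork w b l′ , simulates⇒valid sim) ,
      ext , merge s (lookup-mono Fin.≤-refl sorted) s-onto s-sum ,
      simulates⇒hom sim (fun-init x) ,
      (λ _ → refl) , (λ _ → refl) , λ where
        (inj₁ i) → sym (commutes i)
        (inj₂ j) → cong proj₂ (All.lookup matched (∈-lookup {xs = ps} j))
      where
      ps = e ∷ es
      m′ = length es

      s : Fin (suc m′) → Fin (suc m)
      s = tag ∘ List.lookup ps

      t : Fin (suc m′) → State X
      t = proj₂ ∘ point ∘ List.lookup ps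

      l′ : Vec ℝ⁺ (suc m′)
      l′ = tabulate (amount ∘ List.lookup ps)

      ∑-l′ : ∀ P → ∑[ allFin (suc m′) ∣ P ∘ List.lookup ps ] (value ∘ lookup l′)
                   ≈ ∑[ ps ∣ P ] (value ∘ amount)
      ∑-l′ P = ≈-trans
        (∑∣-cong (allFin (suc m′)) (P ∘ List.lookup ps)
          (λ j → ≡⇒≈ (cong value (lookup∘tabulate (amount ∘ List.lookup ps) j))))
        (≡⇒≈ (∑∣-lookup ps P (value ∘ amount)))

      s-sum : ∀ i → value (lookup l i) ≈ ∑[ allFin (suc m′) ∣ (λ j → s j ≡ i) ] (value ∘ lookup l′)
      s-sum i = begin-equality
        value (lookup l i)                                              ≈⟨ demand-once i ⟩
        ∑[ allFin (suc m) ∣ _≡ i ] (value ∘ lookup l)                   ≈⟨ met i ⟨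
        ∑[ ps ∣ (λ e → tag e ≡ i) ] (value ∘ amount)                    ≈⟨ ∑-l′ (λ e → tag e ≡ i) ⟨
        ∑[ allFin (suc m′) ∣ (λ j → s j ≡ i) ] (value ∘ lookup l′)      ∎

      -- A leaf that receives no piece would have weight zero by `s-sum`.
      s-onto : ∀ i → ∃ λ j → s j ≡ i
      s-onto i with em {∃ λ j → s j ≡ i}
      ... | yes hit = hit
      ... | no  ∄j  = ⊥-elim (0<x⇒x≰0 (positive (lookup l i)) (≈⇒≤ (≈-trans (s-sum i)
        (∑∣-∅ (allFin (suc m′)) (λ j → s j ≡ i) λ {j} _ sj≡i → ∄j (j , sj≡i)))))

      leaves : ∀ z → ∑[ allFin (suc m′) ∣ (λ j → (b , t j) ≡ z) ] (value ∘ lookup l′) ≤ weight μ z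
      leaves z = begin
        ∑[ allFin (suc m′) ∣ (λ j → (b , t j) ≡ z) ] (value ∘ lookup l′)
          ≈⟨ ∑-l′ (λ e → (b , proj₂ (point e)) ≡ z) ⟩
        ∑[ ps ∣ (λ e → (b , proj₂ (point e)) ≡ z) ] (value ∘ amount)
          -- Matching along `map₂ (fun f)` preserves letters, so every piece sits at a
          -- `b`-successor.
          ≤⟨ ∑∣-⊆ ps (value≥0 ∘ amount) (λ {e} e∈ eq →
               trans (cong (_, proj₂ (point e)) (cong proj₁ (All.lookup matched e∈))) eq) ⟩
        ∑[ ps ∣ (λ e → point e ≡ z) ] (value ∘ amount)
          ≤⟨ capacity z ⟩
        available caps (_≡ z)
          ≡⟨ available-caps (_≡ z) ⟩
        ∑[ support μ ∣ _≡ z ] (weight μ)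
          ≤⟨ ∑∣-single (distinct μ) (nonneg μ) z ⟩
        weight μ z ∎

      sim : Simulates (fork w b l′) X [ fun x , t ]′
      sim = fork-simulates {X} {w = w} {l = l′} {fun x} {t}
        (hom⇒simulates (word w , word-valid) x) leaves

  -- The reachable part and bisimilarity

  init-reachable : ∀ X → IsReachable X (init X)
  init-reachable X = ℕ.zero , [] , simulates⇒valid sim , simulates⇒hom sim refl , refl
    where
    sim : Simulates (word []) X (λ _ → init X)
    sim = mkSim λ { Fin.zero z → nonneg (step X (init X)) z }

  -- The word leading to `p` is prolonged by a letter that carries the full weight of the transition
  -- to `q`, which laxness just allows.
  successor-reachable : ∀ {X p} → IsReachable X p → ∀ {a q} → 0ℝ < weight (step X p) (a , q) →
                        IsReachable X q
  successor-reachable {X} (n , w , valid , x , refl) {a} {q} 0< =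
    suc n , w ∷ʳ (a , k) , simulates⇒valid sim , simulates⇒hom sim (fun-init x) ,
    append-fromℕ (fun x) q
    where
    k : ℝ⁺
    k = record { value = weight (step X (fun x (fromℕ n))) (a , q) ; positive = 0< }

    h : Fin (suc (suc n)) → State X
    h = append (fun x) q

    sim : Simulates (word (w ∷ʳ (a , k))) X h
    sim = mkSim go
      where
      go : ∀ i z → massAt (map (map₁ (map₂ h)) (transitions (word (w ∷ʳ (a , k))) i)) z
                   ≤ weight (step X (h i)) z
      go i z with view i
      ... | ‵fromℕ           = nonneg (step X (h (fromℕ (suc n)))) z
      ... | ‵inj₁ (‵inject₁ j)
        rewrite lookup-∷ʳ-inject₁ w (a , k) j
              | append-inject₁ (fun x) q (Fin.suc j)
              | append-inject₁ (fun x) q (inject₁ j) =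
        spine-simulates (hom⇒simulates (word w , valid) x) j z
      -- At the old end of the word the new letter is the only transition.
      ... | ‵inj₁ ‵fromℕ
        rewrite lookup-∷ʳ-fromℕ w (a , k)
              | append-fromℕ (fun x) q
              | append-inject₁ (fun x) q (fromℕ n) =
        ∑∣-[-]-≤ ((a , q) , k) (λ e → proj₁ e ≡ z) (value ∘ proj₂)
          (λ { refl → ≤-refl }) (nonneg (step X (fun x (fromℕ n))) z)

  -- True makes membership proof-irrelevant, so that the inclusion is injective.
  ReachableState : PointedCoalgebra → Set
  ReachableState X = Σ (State X) λ p → True (em {IsReachable X p})

  include : ∀ {X} → A × ReachableState X → A × State X
  include = map₂ proj₁

  include-injective : ∀ {X} {z z′ : A × ReachableState X} →
                      include {X} z ≡ include {X} z′ → z ≡ z′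
  include-injective {z = a , p , r} {.a , .p , r′} refl =
    cong (λ r → a , p , r) (T-irrelevant r r′)

  reachablePart : PointedCoalgebra → PointedCoalgebra
  reachablePart X = record
    { State = ReachableState X
    ; step  = λ (p , _) → Pullback.pullback em (include {X}) (include-injective {X}) (step X p)
    ; init  = init X , fromWitness (init-reachable X)
    }

  -- Successors of positive weight are reachable again, so the omitted states carry no weight.
  include-proper : ∀ X (p : ReachableState X) z →
    weight (F-map proj₁ (step (reachablePart X) p)) z ≈ weight (step X (proj₁ p)) z
  include-proper X (p , r) = Pullback.map-pullback em (include {X}) (include-injective {X}) (step X p)
    λ (a , q) unreached → ≤-antisym (unreachable≤0 unreached) (nonneg (step X p) (a , q))
    where
    unreachable≤0 : ∀ {a q} → ¬ (∃ λ z → include {X} z ≡ (a , q)) → weight (step X p) (a , q) ≤ 0ℝ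
    unreachable≤0 {a} {q} unreached with 0<x⊎x≤0 (weight (step X p) (a , q))
    ... | inj₂ ≤0 = ≤0
    ... | inj₁ 0< = ⊥-elim (unreached
      ((a , q , fromWitness (successor-reachable {X} (toWitness r) 0<)) , refl))

  inclusion : ∀ X → LaxHom (reachablePart X) X
  inclusion X = record
    { fun = proj₁ ; fun-init = refl ; lax = λ p a y → ≈⇒≤ (include-proper X p (a , y)) }

  -- Openness controls `f` at reachable states only, and the inclusion meets no others; being proper
  -- itself, it composes with `f` to a proper map.
  open⇒proper-on-reachablePart : ∀ {X Y} (f : LaxHom X Y) → IsOpen {X} {Y} f →
                                 IsProper {reachablePart X} {Y} (f ⊚ inclusion X)
  open⇒proper-on-reachablePart {X} f f-open (p , r) a y = ≈-trans
    (𝒟≤1-map-∘-≈ (include {X}) (map₂ (fun f)) (step (reachablePart X) (p , r)) (step X p)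
       (include-proper X (p , r)) (a , y))
    (open⇒proper-at f f-open (toWitness r) a y)

theorem5p10 : (em : ExcludedMiddle 0ℓ) (A : Set) → let open Coalgebras em A in
    ((X Y : PointedCoalgebra) (f : LaxHom X Y) →
    (Reachable X → IsOpen {X} {Y} f → IsProper {X} {Y} f)
    × (IsProper {X} {Y} f → IsOpen {X} {Y} f))
    × ((X Y : PointedCoalgebra) → Bisimilar X Y ⇔ CoalgebraicallyBisimilar X Y)
theorem5p10 em A =
  (λ X Y f → (λ reachable f-open p → open⇒proper-at f f-open (reachable p)) , proper⇒open f) ,
  λ X Y → mk⇔
    (λ (Z , f , g , f-open , g-open) →
      -- Reachability concerns `Z` alone, so the same restriction serves both legs.
      reachablePart Z , f ⊚ inclusion Z , g ⊚ inclusion Z ,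
      open⇒proper-on-reachablePart f f-open , open⇒proper-on-reachablePart g g-open)
    (λ (Z , f , g , f-proper , g-proper) → Z , f , g , proper⇒open f f-proper , proper⇒open g g-proper)
  where
  open Coalgebras em A using (LCoalg)
  open Category LCoalg using (_⊚_)
  open Openness em A
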